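{- Let $n\ge 3$. Then $h(n,k)=n$ if $k=1$; $h(n,k)=\sum_{i=n-k}^{n-1}\binom{n}{i}-1$ if $1<k<n$; $h(n,k)=2^n-4$ if $n\le k\le \binom{n-2}{\lfloor n/2\rfloor-1}+1$.
   Context: An antichain in $2^{[n]}$ (where $[n]=\{1,\dots,n\}$) is a family of subsets of $[n]$ none of which is contained in another. For a family $\mathcal{S}$ of subsets of $[n]$ and a query set $Q\subseteq[n]$, the answer to $Q$ is YES if $Q\supseteq S$ for at least one $S\in\mathcal{S}$, and NO otherwise. $h(n,k)$ denotes the smallest size of a family $\mathcal{G}\subseteq 2^{[n]}$ such that for any two distinct antichains $\mathcal{H},\mathcal{H}'$ in $2^{[n]}$ with $|\mathcal{H}|=|\mathcal{H}'|=k$ there is $G\in\mathcal{G}$ whose answer differs for $\mathcal{H}$ and $\mathcal{H}'$, i.e. $G$ contains a member of one of them but no member of the other. -}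

module Defs where

open import Data.Nat using (ℕ; _∸_; _+_; _≤_)
open import Data.Nat.Combinatorics using (_C_)
open import Data.List using (List; length; map; upTo)
open import Data.Nat.ListAction using (sum)
open import Data.List.Membership.Propositional using (_∈_)
open import Data.List.Relation.Unary.Any using (Any)
open import Data.List.Relation.Unary.AllPairs using (AllPairs)
open import Data.List.Relation.Unary.Unique.Propositional using (Unique)
open import Data.Fin.Subset using (Subset; _⊆_)
open import Data.Product using (Σ; _×_; ∃)
open import Data.Sum using (_⊎_)
open import Relation.Nullary using (¬_)
open import Relation.Binary.PropositionalEquality using (_≡_)

Family : ℕ → Set
Family n = List (Subset n)

-- An antichain: members pairwise incomparable (this forces distinct entries).
IsAntichain : ∀ {n} → Family n → Set
IsAntichain F = AllPairs (λ A B → ¬ (A ⊆ B) × ¬ (B ⊆ A)) F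

-- The answer to query Q for family S is YES iff Q ⊇ S for some S ∈ S.
Yes : ∀ {n} → Family n → Subset n → Set
Yes F Q = Any (λ S → S ⊆ Q) F

SameFamily : ∀ {n} → Family n → Family n → Set
SameFamily F F' = ∀ S → (S ∈ F → S ∈ F') × (S ∈ F' → S ∈ F)

Separating : (n k : ℕ) → Family n → Set
Separating n k G =
  ∀ (H H' : Family n) →
    IsAntichain H → length H ≡ k →
    IsAntichain H' → length H' ≡ k →
    ¬ SameFamily H H' →
    ∃ λ Q → Q ∈ G × ((Yes H Q × ¬ Yes H' Q) ⊎ (Yes H' Q × ¬ Yes H Q))

hIs : (n k m : ℕ) → Set
hIs n k m =
  (Σ (Family n) λ G → Unique G × length G ≡ m × Separating n k G)
  × (∀ (G : Family n) → Unique G → Separating n k G → m ≤ length G)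

binomSum : ℕ → ℕ → ℕ
binomSum n k = sum (map (λ j → n C ((n ∸ k) + j)) (upTo k))

{-# OPTIONS --safe #-}
module Submission where

-- The answers to H record the up-set generated by H, and an antichain is the set of
-- minimal elements of its up-set; so G separates iff it meets the symmetric difference
-- of any two distinct up-sets generated by k-element antichains.
--
-- Lower bound: write co i for the complement of {i}.  A set Q with at least two elements
-- missing is forced into G by two antichains Q ∷ F and (Q ∪ {i}) ∷ F, where F contains a
-- set A ∪ {j} with A ⊊ Q for every other j ∉ Q, which makes the up-sets differ in Q only;
-- the rest of F is padding up to size k.  For i ≠ j the antichains co i ∷ F and co j ∷ F,
-- with i and j in every member of F, force co i or co j into G, and when k ≥ n a similar
-- pair forces {a} or {b}.
--
-- Upper bound: let Q be a maximal set on which the up-sets differ.  The antichain not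
-- answering YES on Q has a different member below each Q ∪ {j}, so at most k elements are
-- missing from Q.  Neither a single set co i nor a single {a} (when k ≥ n) can be the only
-- difference, because then the two antichains would have different sizes.

open import Defs
open import Data.Bool using (_≟_)
open import Data.Empty using (⊥-elim)
open import Data.Fin using (Fin; zero; suc; punchIn; punchOut)
import Data.Fin.Properties as Fin
open import Data.Fin.Subset using (Subset; Side; inside; outside; _∈_; _∉_; _⊆_; _∪_; _∩_; ∁; ⁅_⁆; ∣_∣; ⊤; ⊥)
open import Data.Fin.Subset.Properties
open import Data.List using (List; []; _∷_; _++_; length; map; upTo; take; concat; filter; allFin)
open import Data.List.Membership.Propositional using (find; lose) renaming (_∈_ to _∈ₗ_)
import Data.List.Membership.DecPropositional as DecMembership
open import Data.List.Membership.Propositional.Properties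
open import Data.List.Properties using (length-map; length-++; length-take; map-∘; map-cong; length-tabulate)
open import Data.List.Relation.Unary.All as All using (All; []; _∷_)
import Data.List.Relation.Unary.All.Properties as All
open import Data.List.Relation.Unary.AllPairs as AllPairs using ([]; _∷_)
import Data.List.Relation.Unary.AllPairs.Properties as AllPairs
open import Data.List.Relation.Unary.Any as Any using (Any; here; there)
open import Data.List.Relation.Unary.Unique.Propositional using (Unique)
import Data.List.Relation.Unary.Unique.Propositional.Properties as Unique
open import Data.Nat using (ℕ; zero; suc; _≤_; _<_; _∸_; _+_; _^_; ⌊_/2⌋; z≤n; s≤s)
open import Data.Nat.Combinatorics using (_C_; nCk+nC[k+1]≡[n+1]C[k+1])
open import Data.Nat.ListAction using (sum)
open import Data.Nat.Properties hiding (_≟_)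
open import Data.Product using (Σ; ∃; _×_; _,_; proj₁; proj₂)
open import Data.Sum using (_⊎_; inj₁; inj₂; [_,_]′)
open import Data.Vec using (insertAt; lookup; []; _∷_; here; there)
open import Data.Vec.Properties using (≡-dec; ∷-injectiveʳ; []=⇒lookup; lookup⇒[]=; insertAt-lookup; insertAt-punchIn)
open import Function using (_∘_; id; _∋_)
open import Relation.Binary using (DecidableEquality)
open import Relation.Binary.PropositionalEquality using (_≡_; _≢_; refl; sym; trans; cong; cong₂; subst; subst₂; module ≡-Reasoning)
open import Relation.Nullary using (¬_; Dec; yes; no; ¬?; contradiction)
open import Relation.Nullary.Decidable using (decidable-stable; _×-dec_; _⊎-dec_; from-no)

private
  variable
    n k : ℕ
    p q : Subset n
    x y : Fin n
    H H′ G : Family n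

_≟ₛ_ : DecidableEquality (Subset n)
_≟ₛ_ = ≡-dec _≟_

-- Counting with duplicate-free lists

module _ {A B : Set} where

  -- Induction on `as`: the partner `b` of the head is cut out of `bs`, and injectivity keeps it
  -- from being the partner of a later element. Matching by a relation lets membership facts travel
  -- with the pairs.
  injection⇒length≤ : (R : A → B → Set) → (∀ {a a′ b} → R a b → R a′ b → a ≡ a′) →
    ∀ {as bs} → Unique as → (∀ {a} → a ∈ₗ as → ∃ λ b → b ∈ₗ bs × R a b) → length as ≤ length bs
  injection⇒length≤ R inj {[]} [] f = z≤n
  injection⇒length≤ R inj {a ∷ as} {bs} (a∉as ∷ uniq) f
    with b , b∈bs , Rab ← f (here refl)
    with us , vs , refl ← ∈-∃++ b∈bs = begin
      suc (length as)              ≤⟨ s≤s (injection⇒length≤ R inj uniq f′) ⟩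
      suc (length (us ++ vs))      ≡⟨ cong suc (length-++ us) ⟩
      suc (length us + length vs)  ≡⟨ +-suc (length us) (length vs) ⟨
      length us + length (b ∷ vs)  ≡⟨ length-++ us ⟨
      length (us ++ b ∷ vs)        ∎
    where
    open ≤-Reasoning
    f′ : ∀ {a′} → a′ ∈ₗ as → ∃ λ b′ → b′ ∈ₗ us ++ vs × R a′ b′
    f′ a′∈as with f (there a′∈as)
    ... | b′ , b′∈bs , Ra′b′ with ∈-++⁻ us b′∈bs
    ...   | inj₁ b′∈us         = b′ , ∈-++⁺ˡ b′∈us , Ra′b′
    ...   | inj₂ (there b′∈vs) = b′ , ∈-++⁺ʳ us b′∈vs , Ra′b′
    ...   | inj₂ (here refl)   = contradiction (inj Rab Ra′b′) (All.lookup a∉as a′∈as)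

Unique-⊆⇒length≤ : ∀ {A : Set} {as bs : List A} → Unique as → (∀ {a} → a ∈ₗ as → a ∈ₗ bs) → length as ≤ length bs
Unique-⊆⇒length≤ uniq as⊆bs = injection⇒length≤ _≡_ (λ { refl refl → refl }) uniq (λ a∈as → _ , as⊆bs a∈as , refl)

length-concat : ∀ {A : Set} (xss : List (List A)) → length (concat xss) ≡ sum (map length xss)
length-concat [] = refl
length-concat (xs ∷ xss) = trans (length-++ xs) (cong (length xs +_) (length-concat xss))

∈-take : ∀ {A : Set} {a : A} m {as} → a ∈ₗ take m as → a ∈ₗ as
∈-take (suc m) {_ ∷ _} (here eq)   = here eq
∈-take (suc m) {_ ∷ _} (there a∈) = there (∈-take m a∈)

module Remove {A : Set} (_≟ᴬ_ : DecidableEquality A) where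

  remove : A → List A → List A
  remove a = filter (λ b → ¬? (b ≟ᴬ a))

  ∈-remove⁺ : ∀ {a b as} → b ∈ₗ as → b ≢ a → b ∈ₗ remove a as
  ∈-remove⁺ {a} = ∈-filter⁺ (λ b → ¬? (b ≟ᴬ a))

  ∈-remove⁻ : ∀ {a b as} → b ∈ₗ remove a as → b ∈ₗ as × b ≢ a
  ∈-remove⁻ {a} = ∈-filter⁻ (λ b → ¬? (b ≟ᴬ a))

  remove-unique : ∀ a {as} → Unique as → Unique (remove a as)
  remove-unique a = Unique.filter⁺ (λ b → ¬? (b ≟ᴬ a))

  remove-∉ : ∀ {a as} → All (a ≢_) as → remove a as ≡ as
  remove-∉ [] = refl
  remove-∉ {a} {b ∷ as} (a≢b ∷ a∉as) with b ≟ᴬ a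
  ... | yes refl = contradiction refl a≢b
  ... | no _     = cong (b ∷_) (remove-∉ a∉as)

  length-remove : ∀ {a as} → Unique as → a ∈ₗ as → suc (length (remove a as)) ≡ length as
  length-remove {a} {b ∷ as} (b∉as ∷ uniq) a∈ with b ≟ᴬ a | a∈
  ... | yes refl | _         = cong (suc ∘ length) (remove-∉ b∉as)
  ... | no b≢a   | here refl = contradiction refl b≢a
  ... | no _     | there a∈as = cong suc (length-remove uniq a∈as)

module Subsets {n : ℕ} = Remove (_≟ₛ_ {n})
module Elements {n : ℕ} = Remove (Fin._≟_ {n})
open Subsets
open Elements using ()
  renaming (remove to removeᶠ; ∈-remove⁺ to ∈-removeᶠ⁺; ∈-remove⁻ to ∈-removeᶠ⁻;
    remove-unique to removeᶠ-unique; length-remove to length-removeᶠ)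

-- Complements of single points and adjoined points

co : Fin n → Subset n
co i = ∁ ⁅ i ⁆

∈-co⁺ : x ≢ y → x ∈ co y
∈-co⁺ x≢y = x∉p⇒x∈∁p (x≢y⇒x∉⁅y⁆ x≢y)

∈-co⁻ : x ∈ co y → x ≢ y
∈-co⁻ x∈co = x∉⁅y⁆⇒x≢y (x∈∁p⇒x∉p x∈co)

∈-adjoin⁻ : x ∈ p ∪ ⁅ y ⁆ → x ∈ p ⊎ x ≡ y
∈-adjoin⁻ {p = p} {y} x∈ with x∈p∪q⁻ p ⁅ y ⁆ x∈
... | inj₁ x∈p = inj₁ x∈p
... | inj₂ x∈y = inj₂ (x∈⁅y⁆⇒x≡y y x∈y)

⊆-adjoin : p ⊆ p ∪ ⁅ y ⁆
⊆-adjoin {y = y} = p⊆p∪q ⁅ y ⁆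

∈-adjoin : ∀ (p : Subset n) y → y ∈ p ∪ ⁅ y ⁆
∈-adjoin p y = x∈p∪q⁺ (inj₂ (x∈⁅x⁆ y))

adjoin-⊆ : p ⊆ q → y ∈ q → p ∪ ⁅ y ⁆ ⊆ q
adjoin-⊆ p⊆q y∈q x∈ with ∈-adjoin⁻ x∈
... | inj₁ x∈p  = p⊆q x∈p
... | inj₂ refl = y∈q

⁅⁆-⊆ : x ∈ p → ⁅ x ⁆ ⊆ p
⁅⁆-⊆ {x = x} x∈p y∈ with refl ← x∈⁅y⁆⇒x≡y x y∈ = x∈p

⊈⇒∃ : ¬ p ⊆ q → ∃ λ x → x ∈ p × x ∉ q
⊈⇒∃ {p = p} {q} p⊈q with Fin.any? (λ x → x ∈? p ×-dec ¬? (x ∈? q))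
... | yes found = found
... | no ¬found = contradiction (λ {x} x∈p → decidable-stable (x ∈? q) (λ x∉q → ¬found (x , x∈p , x∉q))) p⊈q

⊆∧≢⇒∃ : p ⊆ q → q ≢ p → ∃ λ x → x ∈ q × x ∉ p
⊆∧≢⇒∃ p⊆q q≢p = ⊈⇒∃ (λ q⊆p → q≢p (⊆-antisym q⊆p p⊆q))

⊆∧≢⇒∣∣< : p ⊆ q → q ≢ p → ∣ p ∣ < ∣ q ∣
⊆∧≢⇒∣∣< p⊆q q≢p = p⊂q⇒∣p∣<∣q∣ (p⊆q , ⊆∧≢⇒∃ p⊆q q≢p)

∣p∣+∣∁p∣≡n : ∀ (p : Subset n) → ∣ p ∣ + ∣ ∁ p ∣ ≡ n
∣p∣+∣∁p∣≡n p = trans (cong (∣ p ∣ +_) (∣∁p∣≡n∸∣p∣ p)) (m+[n∸m]≡n (∣p∣≤n p))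

-- Enumerating elements, subsets and layers

elements : Subset n → List (Fin n)
elements []            = []
elements (inside ∷ p)  = zero ∷ map suc (elements p)
elements (outside ∷ p) = map suc (elements p)

length-elements : ∀ (p : Subset n) → length (elements p) ≡ ∣ p ∣
length-elements []            = refl
length-elements (inside ∷ p)  = cong suc (trans (length-map suc (elements p)) (length-elements p))
length-elements (outside ∷ p) = trans (length-map suc (elements p)) (length-elements p)

∈-elements⁺ : x ∈ p → x ∈ₗ elements p
∈-elements⁺ {p = inside ∷ p}  here        = here refl
∈-elements⁺ {p = inside ∷ p}  (there x∈p) = there (∈-map⁺ suc (∈-elements⁺ x∈p))
∈-elements⁺ {p = outside ∷ p} (there x∈p) = ∈-map⁺ suc (∈-elements⁺ x∈p)

∈-elements⁻ : x ∈ₗ elements p → x ∈ p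
∈-elements⁻ {p = inside ∷ p} (here refl) = here
∈-elements⁻ {p = inside ∷ p} (there x∈) with _ , y∈ , refl ← ∈-map⁻ suc x∈ = there (∈-elements⁻ y∈)
∈-elements⁻ {p = outside ∷ p} x∈ with _ , y∈ , refl ← ∈-map⁻ suc x∈ = there (∈-elements⁻ y∈)

elements-unique : ∀ (p : Subset n) → Unique (elements p)
elements-unique []            = []
elements-unique (inside ∷ p)  = All.map⁺ (All.universal (λ _ ()) (elements p)) ∷ Unique.map⁺ Fin.suc-injective (elements-unique p)
elements-unique (outside ∷ p) = Unique.map⁺ Fin.suc-injective (elements-unique p)

∷-disjoint : ∀ {as bs : Family n} {a} → ¬ (a ∈ₗ map (inside ∷_) as × a ∈ₗ map (outside ∷_) bs)
∷-disjoint (a∈as , a∈bs) with _ , _ , refl ← ∈-map⁻ (inside ∷_) a∈as | _ , _ , () ← ∈-map⁻ (outside ∷_) a∈bs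

subsets : ∀ n → Family n
subsets zero    = [] ∷ []
subsets (suc n) = map (inside ∷_) (subsets n) ++ map (outside ∷_) (subsets n)

length-subsets : ∀ n → length (subsets n) ≡ 2 ^ n
length-subsets zero    = refl
length-subsets (suc n) = trans (length-++ (map (inside ∷_) (subsets n))) (cong₂ _+_
  (trans (length-map _ (subsets n)) (length-subsets n))
  (trans (length-map _ (subsets n)) (trans (length-subsets n) (sym (+-identityʳ _)))))

∈-subsets : ∀ (p : Subset n) → p ∈ₗ subsets n
∈-subsets []            = here refl
∈-subsets (inside ∷ p)  = ∈-++⁺ˡ (∈-map⁺ _ (∈-subsets p))
∈-subsets (outside ∷ p) = ∈-++⁺ʳ _ (∈-map⁺ _ (∈-subsets p))

subsets-unique : ∀ n → Unique (subsets n)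
subsets-unique zero    = [] ∷ []
subsets-unique (suc n) = Unique.++⁺ (Unique.map⁺ ∷-injectiveʳ (subsets-unique n)) (Unique.map⁺ ∷-injectiveʳ (subsets-unique n)) ∷-disjoint

-- Splitting on the first coordinate is Pascal's rule, which makes the count `n C r` a direct
-- induction.
layer : ∀ n → ℕ → Family n
layer zero    zero    = [] ∷ []
layer zero    (suc r) = []
layer (suc n) zero    = map (outside ∷_) (layer n zero)
layer (suc n) (suc r) = map (inside ∷_) (layer n r) ++ map (outside ∷_) (layer n (suc r))

length-layer : ∀ n r → length (layer n r) ≡ n C r
length-layer zero    zero    = refl
length-layer zero    (suc r) = refl
length-layer (suc n) zero    = trans (length-map _ (layer n zero)) (length-layer n zero)
length-layer (suc n) (suc r) = trans (length-++ (map (inside ∷_) (layer n r))) (trans (cong₂ _+_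
  (trans (length-map _ (layer n r)) (length-layer n r))
  (trans (length-map _ (layer n (suc r))) (length-layer n (suc r))))
  (nCk+nC[k+1]≡[n+1]C[k+1] n r))

∈-layer⁺ : ∀ (p : Subset n) → p ∈ₗ layer n ∣ p ∣
∈-layer⁺ [] = here refl
∈-layer⁺ (inside ∷ p) = ∈-++⁺ˡ (∈-map⁺ _ (∈-layer⁺ p))
∈-layer⁺ (outside ∷ p) with ∣ p ∣ | ∈-layer⁺ p
... | zero  | p∈ = ∈-map⁺ _ p∈
... | suc r | p∈ = ∈-++⁺ʳ _ (∈-map⁺ _ p∈)

∈-layer⁻ : ∀ n r {p} → p ∈ₗ layer n r → ∣ p ∣ ≡ r
∈-layer⁻ zero    zero (here refl) = refl
∈-layer⁻ (suc n) zero p∈ with _ , q∈ , refl ← ∈-map⁻ _ p∈ = ∈-layer⁻ n zero q∈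
∈-layer⁻ (suc n) (suc r) p∈ with ∈-++⁻ (map (inside ∷_) (layer n r)) p∈
... | inj₁ p∈ˡ with _ , q∈ , refl ← ∈-map⁻ _ p∈ˡ = cong suc (∈-layer⁻ n r q∈)
... | inj₂ p∈ʳ with _ , q∈ , refl ← ∈-map⁻ _ p∈ʳ = ∈-layer⁻ n (suc r) q∈

layer-unique : ∀ n r → Unique (layer n r)
layer-unique zero    zero    = [] ∷ []
layer-unique zero    (suc r) = []
layer-unique (suc n) zero    = Unique.map⁺ ∷-injectiveʳ (layer-unique n zero)
layer-unique (suc n) (suc r) = Unique.++⁺ (Unique.map⁺ ∷-injectiveʳ (layer-unique n r)) (Unique.map⁺ ∷-injectiveʳ (layer-unique n (suc r))) ∷-disjoint

-- For `k ≤ n` the sizes run from n - k to n - 1. The indexing is that of `binomSum`, so the lengths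
-- agree term by term.
layers : ∀ n k → Family n
layers n k = concat (map (λ j → layer n ((n ∸ k) + j)) (upTo k))

length-layers : ∀ n k → length (layers n k) ≡ binomSum n k
length-layers n k = trans (length-concat (map _ (upTo k)))
  (cong sum (trans (sym (map-∘ (upTo k))) (map-cong (λ j → length-layer n ((n ∸ k) + j)) (upTo k))))

layers-unique : ∀ n k → Unique (layers n k)
layers-unique n k = Unique.concat⁺
  (All.map⁺ (All.universal (λ j → layer-unique n ((n ∸ k) + j)) (upTo k)))
  (AllPairs.map⁺ (AllPairs.map (λ i≢j {v} (a , b) → i≢j (+-cancelˡ-≡ (n ∸ k) _ _ (trans (sym (∈-layer⁻ n _ a)) (∈-layer⁻ n _ b)))) (Unique.upTo⁺ k)))

∈-layers⁺ : k ≤ n → ∀ (p : Subset n) → n ∸ k ≤ ∣ p ∣ → ∣ p ∣ < n → p ∈ₗ layers n k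
∈-layers⁺ {k} {n} k≤n p lo hi = ∈-concat⁺′ (subst (λ r → p ∈ₗ layer n r) (sym eq) (∈-layer⁺ p)) (∈-map⁺ _ (∈-upTo⁺ j<k))
  where
  eq : (n ∸ k) + (∣ p ∣ ∸ (n ∸ k)) ≡ ∣ p ∣
  eq = m+[n∸m]≡n lo
  j<k : ∣ p ∣ ∸ (n ∸ k) < k
  j<k = +-cancelˡ-< (n ∸ k) _ _ (subst₂ _<_ (sym eq) (sym (m∸n+n≡m k≤n)) hi)

∈-layers⁻ : k ≤ n → ∀ {p : Subset n} → p ∈ₗ layers n k → n ∸ k ≤ ∣ p ∣ × ∣ p ∣ < n
∈-layers⁻ {k} {n} k≤n {p} p∈ with _ , p∈l , l∈ ← ∈-concat⁻′ (map _ (upTo k)) p∈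
  with j , j∈ , refl ← ∈-map⁻ _ l∈ =
    subst (n ∸ k ≤_) (sym ∣p∣≡) (m≤m+n _ j) , subst₂ _<_ (sym ∣p∣≡) (m∸n+n≡m k≤n) (+-monoʳ-< (n ∸ k) (∈-upTo⁻ j∈))
  where
  ∣p∣≡ : ∣ p ∣ ≡ (n ∸ k) + j
  ∣p∣≡ = ∈-layer⁻ n _ p∈l

∣p∣≥1⇒∃ : ∀ (p : Subset n) → 1 ≤ ∣ p ∣ → ∃ (_∈ p)
∣p∣≥1⇒∃ p 1≤ with elements p | length-elements p | (λ x → ∈-elements⁻ {x = x} {p = p})
... | x ∷ _ | _  | back = x , back _ (here refl)
... | []    | eq | _    = contradiction (subst (1 ≤_) (sym eq) 1≤) λ ()

∣p∣≥2⇒∃₂ : ∀ (p : Subset n) → 2 ≤ ∣ p ∣ → ∃ λ x → ∃ λ y → x ≢ y × x ∈ p × y ∈ p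
∣p∣≥2⇒∃₂ p 2≤ with elements p | length-elements p | (λ x → ∈-elements⁻ {x = x} {p = p}) | elements-unique p
... | x ∷ y ∷ _ | _  | back | (x≢y ∷ _) ∷ _ = x , y , x≢y , back _ (here refl) , back _ (there (here refl))
... | []        | eq | _    | _ = contradiction (subst (2 ≤_) (sym eq) 2≤) λ ()
... | _ ∷ []    | eq | _    | _ = contradiction (subst (2 ≤_) (sym eq) 2≤) λ { (s≤s ()) }

-- Antichains and the up-sets they generate

Incomparable : Subset n → Subset n → Set
Incomparable p q = ¬ p ⊆ q × ¬ q ⊆ p

Yes? : ∀ (H : Family n) P → Dec (Yes H P)
Yes? H P = Any.any? (_⊆? P) H

∈-family? : ∀ (P : Subset n) (G : Family n) → Dec (P ∈ₗ G)
∈-family? = DecMembership._∈?_ _≟ₛ_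

antichain-unique : IsAntichain H → Unique H
antichain-unique = AllPairs.map (λ { (p⊈q , _) refl → p⊈q id })

antichain-≡ : IsAntichain H → p ∈ₗ H → q ∈ₗ H → p ⊆ q → p ≡ q
antichain-≡ anti p∈H q∈H p⊆q with ∈-AllPairs₂ anti p∈H q∈H
... | inj₁ p≡q                = p≡q
... | inj₂ (inj₁ (p⊈q , _)) = contradiction (λ {_} → p⊆q) p⊈q
... | inj₂ (inj₂ (_ , p⊈q)) = contradiction (λ {_} → p⊆q) p⊈q

antichain-other : IsAntichain H → 2 ≤ length H → ∀ p → ∃ λ q → q ∈ₗ H × q ≢ p
antichain-other {H = a ∷ b ∷ H} (((a⊈b , _) ∷ _) ∷ _) (s≤s (s≤s _)) p with p ≟ₛ a
... | yes refl = b , there (here refl) , λ { refl → a⊈b id }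
... | no p≢a   = a , here refl , λ a≡p → p≢a (sym a≡p)

map-antichain : ∀ {A : Set} (f : A → Subset n) {as} → Unique as →
  (∀ {a b} → a ∈ₗ as → b ∈ₗ as → f a ⊆ f b → a ≡ b) → IsAntichain (map f as)
map-antichain f {[]} [] inj = []
map-antichain f {a ∷ as} (a∉as ∷ uniq) inj =
  All.map⁺ (All.tabulate (λ b∈as →
    (λ fa⊆fb → All.lookup a∉as b∈as (inj (here refl) (there b∈as) fa⊆fb)) ,
    (λ fb⊆fa → All.lookup a∉as b∈as (sym (inj (there b∈as) (here refl) fb⊆fa))))) ∷
  map-antichain f uniq (λ b∈ c∈ → inj (there b∈) (there c∈))

++-antichain : IsAntichain H → IsAntichain H′ → (∀ {p q} → p ∈ₗ H → q ∈ₗ H′ → Incomparable p q) → IsAntichain (H ++ H′)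
++-antichain anti anti′ cross = AllPairs.++⁺ anti anti′ (All.tabulate (λ p∈ → All.tabulate (cross p∈)))

-- A member inside the empty set would be empty and so lie below every other member.
¬Yes⊥ : IsAntichain H → 2 ≤ length H → ¬ Yes H ⊥
¬Yes⊥ anti 2≤ yes⊥ with S , S∈H , S⊆⊥ ← find yes⊥
  with T , T∈H , T≢S ← antichain-other anti 2≤ S =
    T≢S (sym (antichain-≡ anti S∈H T∈H (λ x∈S → contradiction (S⊆⊥ x∈S) ∉⊥)))

Yes-mono : p ⊆ q → Yes H p → Yes H q
Yes-mono p⊆q y with S , S∈H , S⊆p ← find y = lose S∈H (λ x∈S → p⊆q (S⊆p x∈S))

Yes⊤ : 1 ≤ length H → Yes H ⊤
Yes⊤ {H = _ ∷ _} _ = here ⊆⊤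

-- The members of an antichain are the minimal sets of the up-set it generates.
minimal-transfer : IsAntichain H → p ∈ₗ H → Yes H′ p → (∀ q → q ⊆ p → Yes H′ q → Yes H q) → p ∈ₗ H′
minimal-transfer anti p∈H yes′ back with T , T∈H′ , T⊆p ← find yes′
  with S , S∈H , S⊆T ← find (back T T⊆p (lose T∈H′ id))
  with refl ← antichain-≡ anti S∈H p∈H (λ x∈S → T⊆p (S⊆T x∈S))
  with refl ← ⊆-antisym T⊆p S⊆T = T∈H′

Yes-determines : IsAntichain H → IsAntichain H′ → (∀ P → Yes H P → Yes H′ P) → (∀ P → Yes H′ P → Yes H P) → SameFamily H H′
Yes-determines anti anti′ f g S =
  (λ S∈H → minimal-transfer anti S∈H (f S (lose S∈H id)) (λ q _ → g q)) ,
  (λ S∈H′ → minimal-transfer anti′ S∈H′ (g S (lose S∈H′ id)) (λ q _ → f q))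

-- Criteria for separation

-- Answers are decidable and `G` is a finite list, so a search either returns a separating query or
-- shows that the families agree on all of `G`.
separating-intro : (G : Family n) →
  (∀ {H H′} → IsAntichain H → length H ≡ k → IsAntichain H′ → length H′ ≡ k →
    (∀ {Q} → Q ∈ₗ G → Yes H Q → Yes H′ Q) → (∀ {Q} → Q ∈ₗ G → Yes H′ Q → Yes H Q) → SameFamily H H′) →
  Separating n k G
separating-intro {n} G same H H′ anti len anti′ len′ diff = conclude (Any.any? differs? G)
  where
  Differs : Subset n → Set
  Differs Q = (Yes H Q × ¬ Yes H′ Q) ⊎ (Yes H′ Q × ¬ Yes H Q)
  differs? : ∀ Q → Dec (Differs Q)
  differs? Q = (Yes? H Q ×-dec ¬? (Yes? H′ Q)) ⊎-dec (Yes? H′ Q ×-dec ¬? (Yes? H Q))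
  conclude : Dec (Any Differs G) → ∃ λ Q → Q ∈ₗ G × Differs Q
  conclude (yes found) = find found
  conclude (no none) = contradiction (same anti len anti′ len′
    (λ {Q} Q∈G y → decidable-stable (Yes? H′ Q) (λ ny → none (lose Q∈G (inj₁ (y , ny)))))
    (λ {Q} Q∈G y → decidable-stable (Yes? H Q) (λ ny → none (lose Q∈G (inj₂ (y , ny)))))) diff

SameFamily⇒Yes : SameFamily H H′ → Yes H p → Yes H′ p
SameFamily⇒Yes same y with S , S∈H , S⊆p ← find y = lose (proj₁ (same S) S∈H) S⊆p

-- The query `Q` shows that the families differ, so `G` holds a set on which the answers disagree;
-- the two implications leave only `A` or `B`. Taking `A` and `B` equal forces a single set.
separating-hits : Separating n k G → IsAntichain H → length H ≡ k → IsAntichain H′ → length H′ ≡ k →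
  ∀ A B → (∀ P → P ≢ A → Yes H P → Yes H′ P) → (∀ P → P ≢ B → Yes H′ P → Yes H P) →
  ∀ {Q} → Yes H Q → ¬ Yes H′ Q → A ∈ₗ G ⊎ B ∈ₗ G
separating-hits {H = H} {H′} sep anti len anti′ len′ A B f g {Q} yesQ noQ
  with sep H H′ anti len anti′ len′ (λ same → noQ (SameFamily⇒Yes same yesQ))
... | P , P∈G , inj₁ (y , ny) = inj₁ (subst (_∈ₗ _) (decidable-stable (P ≟ₛ A) (λ P≢A → ny (f P P≢A y))) P∈G)
... | P , P∈G , inj₂ (y , ny) = inj₂ (subst (_∈ₗ _) (decidable-stable (P ≟ₛ B) (λ P≢B → ny (g P P≢B y))) P∈G)

-- If `f i₀` is missing from `G`, every pair with `i₀` yields its other value; if nothing is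
-- missing, `z` serves as a default exception.
∃-all-but-one : (f : Fin n → Subset n) (G : Family n) → Fin n → (∀ i j → i ≢ j → f i ∈ₗ G ⊎ f j ∈ₗ G) →
  ∃ λ i₀ → ∀ i → i ≢ i₀ → f i ∈ₗ G
∃-all-but-one f G z pair with Fin.any? (λ i → ¬? (∈-family? (f i) G))
... | no none = z , λ i _ → decidable-stable (∈-family? (f i) G) (λ fi∉ → none (i , fi∉))
... | yes (i₀ , fi₀∉) = i₀ , λ i i≢i₀ → [ id , (λ fi₀∈ → contradiction fi₀∈ fi₀∉) ]′ (pair i i₀ i≢i₀)

co⊆∧∋⇒⊤⊆ : co x ⊆ p → x ∈ p → ⊤ ⊆ p
co⊆∧∋⇒⊤⊆ {x = x} co⊆p x∈p {y} _ with y Fin.≟ x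
... | yes refl = x∈p
... | no y≢x   = co⊆p (∈-co⁺ y≢x)

-- Together with `co⊆∧∋⇒⊤⊆` this says that only the full set lies properly above `co x`.
co⊆∧≢⇒∋ : co x ⊆ p → p ≢ co x → x ∈ p
co⊆∧≢⇒∋ {x = x} co⊆p p≢co with y , y∈p , y∉co ← ⊆∧≢⇒∃ co⊆p p≢co
  with refl ← decidable-stable (y Fin.≟ x) (λ y≢x → y∉co (∈-co⁺ y≢x)) = y∈p

-- Lower bounds

-- Above `co i` there is only the full set, which contains everything, so exchanging `co i` for
-- `co j` changes the answers at these two sets only. Members of `F` contain `i` and `j`, hence lie
-- below neither, and not being full they lie above neither.
top-pair : Separating n k G → ∀ {i j} → i ≢ j → {F : Family n} → IsAntichain F → suc (length F) ≡ k →
  (∀ {Y} → Y ∈ₗ F → i ∈ Y × j ∈ Y × ¬ ⊤ ⊆ Y) → co i ∈ₗ G ⊎ co j ∈ₗ G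
top-pair {n} sep {i} {j} i≢j {F} anti len good =
  separating-hits sep (extend i (λ Y∈ → let a , _ , c = good Y∈ in a , c)) len
                      (extend j (λ Y∈ → let _ , b , c = good Y∈ in b , c)) len
                      (co i) (co j) (step i j) (step j i) (here id) no-ij
  where
  extend : ∀ l → (∀ {Y} → Y ∈ₗ F → l ∈ Y × ¬ ⊤ ⊆ Y) → IsAntichain (co l ∷ F)
  extend l ok = All.tabulate (λ Y∈ → let l∈Y , notfull = ok Y∈ in
    (λ co⊆Y → notfull (co⊆∧∋⇒⊤⊆ co⊆Y l∈Y)) , (λ Y⊆co → ∈-co⁻ (Y⊆co l∈Y) refl)) ∷ anti
  step : ∀ l m P → P ≢ co l → Yes (co l ∷ F) P → Yes (co m ∷ F) P
  step l m P P≢ (there y) = there y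
  step l m P P≢ (here co⊆P) = here (λ _ → co⊆∧∋⇒⊤⊆ co⊆P (co⊆∧≢⇒∋ co⊆P P≢) ∈⊤)
  no-ij : ¬ Yes (co j ∷ F) (co i)
  no-ij (here coj⊆coi) = ∈-co⁻ (coj⊆coi (∈-co⁺ i≢j)) refl
  no-ij (there y) with Y , Y∈F , Y⊆co ← find y = ∈-co⁻ (Y⊆co (proj₁ (good Y∈F))) refl

-- `star c d` has the singleton of `c`, the pairs of `d` with each point other than `c` and `d`, and
-- `F`: in all 1 + (n - 2) + |F| = k members. Swapping the roles of `a` and `b` changes the up-set
-- at the two singletons only.
bottom-pair : Separating n k G → ∀ {a b} → a ≢ b → {F : Family n} → IsAntichain F → n + length F ≡ suc k →
  (∀ {Y} → Y ∈ₗ F → a ∉ Y × b ∉ Y × (∀ j → ¬ Y ⊆ ⁅ j ⁆)) → ⁅ a ⁆ ∈ₗ G ⊎ ⁅ b ⁆ ∈ₗ G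
bottom-pair {n} {k} sep {a} {b} a≢b {F} anti len good =
  separating-hits sep (star-antichain a b a≢b J⇒≢a good) (star-length a b)
    (star-antichain b a (a≢b ∘ sym) J⇒≢b good′) (star-length b a)
    ⁅ a ⁆ ⁅ b ⁆ (step a b ∈-J⁺) (step b a (λ l≢b l≢a → ∈-J⁺ l≢a l≢b)) (here id) no-ab
  where
  good′ : ∀ {Y} → Y ∈ₗ F → b ∉ Y × a ∉ Y × (∀ j → ¬ Y ⊆ ⁅ j ⁆)
  good′ Y∈ with u , v , w ← good Y∈ = v , u , w
  J : List (Fin n)
  J = removeᶠ b (removeᶠ a (allFin n))
  J⇒≢a : ∀ {j} → j ∈ₗ J → j ≢ a × j ≢ b
  J⇒≢a j∈ with j∈′ , j≢b ← ∈-removeᶠ⁻ j∈ = proj₂ (∈-removeᶠ⁻ {as = allFin n} j∈′) , j≢b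
  J⇒≢b : ∀ {j} → j ∈ₗ J → j ≢ b × j ≢ a
  J⇒≢b j∈ with u , v ← J⇒≢a j∈ = v , u
  ∈-J⁺ : ∀ {j} → j ≢ a → j ≢ b → j ∈ₗ J
  ∈-J⁺ j≢a j≢b = ∈-removeᶠ⁺ (∈-removeᶠ⁺ (∈-allFin _) j≢a) j≢b
  J-unique : Unique J
  J-unique = removeᶠ-unique b (removeᶠ-unique a (Unique.allFin⁺ n))
  J-length : 2 + length J ≡ n
  J-length = trans (cong suc (length-removeᶠ (removeᶠ-unique a (Unique.allFin⁺ n)) (∈-removeᶠ⁺ (∈-allFin b) (a≢b ∘ sym))))
    (trans (length-removeᶠ (Unique.allFin⁺ n) (∈-allFin a)) (length-tabulate {n = n} id))
  edges : Fin n → Family n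
  edges d = map (λ j → ⁅ d ⁆ ∪ ⁅ j ⁆) J
  star : Fin n → Fin n → Family n
  star c d = ⁅ c ⁆ ∷ edges d ++ F
  star-length : ∀ c d → length (star c d) ≡ k
  star-length c d = suc-injective (begin
    2 + length (edges d ++ F)          ≡⟨ cong (2 +_) (length-++ (edges d)) ⟩
    2 + (length (edges d) + length F)  ≡⟨ cong (λ l → 2 + (l + length F)) (length-map _ J) ⟩
    2 + length J + length F            ≡⟨ cong (_+ length F) J-length ⟩
    n + length F                       ≡⟨ len ⟩
    suc k                              ∎)
    where open ≡-Reasoning
  star-antichain : ∀ c d → c ≢ d → (∀ {j} → j ∈ₗ J → j ≢ c × j ≢ d) →
    (∀ {Y} → Y ∈ₗ F → c ∉ Y × d ∉ Y × (∀ j → ¬ Y ⊆ ⁅ j ⁆)) → IsAntichain (star c d)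
  star-antichain c d c≢d J⇒ good = All.tabulate c-vs ∷ ++-antichain (map-antichain _ J-unique edge-inj) anti edge-vs
    where
    edge-inj : ∀ {j l} → j ∈ₗ J → l ∈ₗ J → ⁅ d ⁆ ∪ ⁅ j ⁆ ⊆ ⁅ d ⁆ ∪ ⁅ l ⁆ → j ≡ l
    edge-inj {j} j∈ l∈ sub with ∈-adjoin⁻ (sub (∈-adjoin ⁅ d ⁆ j))
    ... | inj₁ j∈d = contradiction (x∈⁅y⁆⇒x≡y d j∈d) (proj₂ (J⇒ j∈))
    ... | inj₂ j≡l = j≡l
    edge-vs : ∀ {P Y} → P ∈ₗ edges d → Y ∈ₗ F → Incomparable P Y
    edge-vs {Y = Y} P∈ Y∈ with j , _ , refl ← ∈-map⁻ _ P∈ | _ , d∉Y , nonsingle ← good Y∈ =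
      (λ sub → d∉Y (sub (⊆-adjoin (x∈⁅x⁆ d)))) , (λ sub → nonsingle j (restrict sub))
      where
      restrict : Y ⊆ ⁅ d ⁆ ∪ ⁅ j ⁆ → Y ⊆ ⁅ j ⁆
      restrict sub x∈Y with ∈-adjoin⁻ (sub x∈Y)
      ... | inj₁ x∈d  = contradiction (subst (_∈ Y) (x∈⁅y⁆⇒x≡y d x∈d) x∈Y) d∉Y
      ... | inj₂ refl = x∈⁅x⁆ j
    c-vs : ∀ {P} → P ∈ₗ edges d ++ F → Incomparable ⁅ c ⁆ P
    c-vs P∈ with ∈-++⁻ (edges d) P∈
    ... | inj₂ Y∈ with c∉Y , _ , nonsingle ← good Y∈ = (λ sub → c∉Y (sub (x∈⁅x⁆ c))) , nonsingle c
    ... | inj₁ e∈ with j , j∈ , refl ← ∈-map⁻ _ e∈ =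
      (λ sub → [ (λ c∈d → c≢d (x∈⁅y⁆⇒x≡y d c∈d)) , (λ c≡j → proj₁ (J⇒ j∈) (sym c≡j)) ]′ (∈-adjoin⁻ (sub (x∈⁅x⁆ c)))) ,
      (λ sub → proj₁ (J⇒ j∈) (x∈⁅y⁆⇒x≡y c (sub (∈-adjoin ⁅ d ⁆ j))))
  step : ∀ c d → (∀ {l} → l ≢ c → l ≢ d → l ∈ₗ J) → ∀ P → P ≢ ⁅ c ⁆ → Yes (star c d) P → Yes (star d c) P
  step c d ∈J P P≢c yesP with find yesP
  ... | _ , there S∈ , S⊆P with ∈-++⁻ (edges d) S∈
  ...   | inj₂ S∈F = lose (there (∈-++⁺ʳ (edges c) S∈F)) S⊆P
  ...   | inj₁ S∈e with j , _ , refl ← ∈-map⁻ _ S∈e = here (λ x∈d → S⊆P (⊆-adjoin x∈d))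
  -- A proper superset of `⁅ c ⁆` contains `d`, whose singleton is in the other star, or another
  -- point `y`, and the pair of `c` and `y` is an edge there.
  step c d ∈J P P≢c yesP | _ , here refl , c⊆P with y , y∈P , y∉c ← ⊆∧≢⇒∃ c⊆P P≢c with y Fin.≟ d
  ... | yes refl = here (⁅⁆-⊆ y∈P)
  ... | no y≢d   = lose (there (∈-++⁺ˡ (∈-map⁺ _ (∈J (x∉⁅y⁆⇒x≢y y∉c) y≢d)))) (adjoin-⊆ c⊆P y∈P)
  no-ab : ¬ Yes (star b a) ⁅ a ⁆
  no-ab yesa with find yesa
  ... | _ , here refl , b⊆a = a≢b (sym (x∈⁅y⁆⇒x≡y a (b⊆a (x∈⁅x⁆ b))))
  ... | _ , there S∈ , S⊆a with ∈-++⁻ (edges a) S∈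
  ...   | inj₂ S∈F = proj₂ (proj₂ (good S∈F)) a S⊆a
  ...   | inj₁ S∈e with j , j∈ , refl ← ∈-map⁻ _ S∈e = proj₁ (J⇒≢a j∈) (x∈⁅y⁆⇒x≡y a (S⊆a (∈-adjoin ⁅ a ⁆ j)))

-- The up-sets of Q ∷ F and (Q ∪ ⁅ i ⁆) ∷ F differ exactly in Q.
forced : Separating n k G → ∀ {Q i A} → i ∉ Q → A ⊆ Q → ¬ Q ⊆ A → {Ys : Family n} → IsAntichain Ys →
  ∣ ∁ Q ∣ + length Ys ≡ k →
  (∀ {Y} → Y ∈ₗ Ys → ¬ Y ⊆ Q ∪ ⁅ i ⁆ × ¬ Q ⊆ Y × (∀ {j} → j ∉ Q → j ≢ i → Incomparable (A ∪ ⁅ j ⁆) Y)) → Q ∈ₗ G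
forced {n} {k} sep {Q} {i} {A} i∉Q A⊆Q Q⊈A {Ys} anti len good =
  [ id , id ]′ (separating-hits sep (All.tabulate Q-vs ∷ F-antichain) F-length (All.tabulate Qi-vs ∷ F-antichain) F-length
    Q Q down up (here id) no-Q)
  where
  J : List (Fin n)
  J = removeᶠ i (elements (∁ Q))
  J⇒ : ∀ {j} → j ∈ₗ J → j ∉ Q × j ≢ i
  J⇒ j∈ with j∈′ , j≢i ← ∈-removeᶠ⁻ j∈ = x∈∁p⇒x∉p (∈-elements⁻ j∈′) , j≢i
  petals F : Family n
  petals = map (λ j → A ∪ ⁅ j ⁆) J
  F = petals ++ Ys
  F-length : suc (length F) ≡ k
  F-length = begin
    suc (length F)                      ≡⟨ cong suc (length-++ petals) ⟩
    suc (length petals + length Ys)     ≡⟨ cong (λ l → suc l + length Ys) (length-map _ J) ⟩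
    suc (length J) + length Ys          ≡⟨ cong (_+ length Ys) (length-removeᶠ (elements-unique (∁ Q)) (∈-elements⁺ (x∉p⇒x∈∁p i∉Q))) ⟩
    length (elements (∁ Q)) + length Ys ≡⟨ cong (_+ length Ys) (length-elements (∁ Q)) ⟩
    ∣ ∁ Q ∣ + length Ys                 ≡⟨ len ⟩
    k                                   ∎
    where open ≡-Reasoning
  petal-inj : ∀ {j l} → j ∈ₗ J → l ∈ₗ J → A ∪ ⁅ j ⁆ ⊆ A ∪ ⁅ l ⁆ → j ≡ l
  petal-inj {j} j∈ l∈ sub with ∈-adjoin⁻ (sub (∈-adjoin A j))
  ... | inj₁ j∈A = contradiction (A⊆Q j∈A) (proj₁ (J⇒ j∈))
  ... | inj₂ j≡l = j≡l
  petal-vs : ∀ {P Y} → P ∈ₗ petals → Y ∈ₗ Ys → Incomparable P Y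
  petal-vs P∈ Y∈ with j , j∈ , refl ← ∈-map⁻ _ P∈ | _ , _ , incomp ← good Y∈ = incomp (proj₁ (J⇒ j∈)) (proj₂ (J⇒ j∈))
  F-antichain : IsAntichain F
  F-antichain = ++-antichain (map-antichain _ (removeᶠ-unique i (elements-unique (∁ Q))) petal-inj) anti petal-vs
  Q⊈petal : ∀ {j} → j ∉ Q → ¬ Q ⊆ A ∪ ⁅ j ⁆
  -- A petal adds to `A` only a point outside `Q`, so a point of `Q` missing from `A` stays missing.
  Q⊈petal j∉Q sub = Q⊈A (λ x∈Q → [ id , (λ { refl → contradiction x∈Q j∉Q }) ]′ (∈-adjoin⁻ (sub x∈Q)))
  F-avoids : ∀ {P} → P ∈ₗ F → ¬ Q ⊆ P × ¬ P ⊆ Q ∪ ⁅ i ⁆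
  F-avoids P∈ with ∈-++⁻ petals P∈
  ... | inj₂ Y∈ with u , v , _ ← good Y∈ = v , u
  ... | inj₁ S∈ with j , j∈ , refl ← ∈-map⁻ _ S∈ = Q⊈petal (proj₁ (J⇒ j∈)) ,
    (λ sub → [ proj₁ (J⇒ j∈) , proj₂ (J⇒ j∈) ]′ (∈-adjoin⁻ (sub (∈-adjoin A j))))
  Q-vs : ∀ {P} → P ∈ₗ F → Incomparable Q P
  Q-vs P∈ = proj₁ (F-avoids P∈) , (λ sub → proj₂ (F-avoids P∈) (λ x∈P → ⊆-adjoin (sub x∈P)))
  Qi-vs : ∀ {P} → P ∈ₗ F → Incomparable (Q ∪ ⁅ i ⁆) P
  Qi-vs P∈ = (λ sub → proj₁ (F-avoids P∈) (λ x∈Q → sub (⊆-adjoin x∈Q))) , proj₂ (F-avoids P∈)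
  down : ∀ P → P ≢ Q → Yes (Q ∷ F) P → Yes ((Q ∪ ⁅ i ⁆) ∷ F) P
  down P P≢Q (there y) = there y
  -- `P` has a point `y` outside `Q`: for `y` equal to `i` it contains `Q ∪ ⁅ i ⁆`, otherwise it
  -- contains the petal at `y`.
  down P P≢Q (here Q⊆P) with y , y∈P , y∉Q ← ⊆∧≢⇒∃ Q⊆P P≢Q with y Fin.≟ i
  ... | yes refl = here (adjoin-⊆ Q⊆P y∈P)
  ... | no y≢i   = there (lose (∈-++⁺ˡ (∈-map⁺ _ (∈-removeᶠ⁺ (∈-elements⁺ (x∉p⇒x∈∁p y∉Q)) y≢i)))
                          (adjoin-⊆ (λ x∈A → Q⊆P (A⊆Q x∈A)) y∈P))
  up : ∀ P → P ≢ Q → Yes ((Q ∪ ⁅ i ⁆) ∷ F) P → Yes (Q ∷ F) P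
  up P _ (there y)     = there y
  up P _ (here Qi⊆P) = here (λ x∈Q → Qi⊆P (⊆-adjoin x∈Q))
  no-Q : ¬ Yes ((Q ∪ ⁅ i ⁆) ∷ F) Q
  no-Q (here Qi⊆Q) = i∉Q (Qi⊆Q (∈-adjoin Q i))
  no-Q (there y) with Y , Y∈F , Y⊆Q ← find y = proj₂ (Q-vs Y∈F) Y⊆Q

-- Upper bounds

-- A member below `Q ∪ ⁅ j ⁆` but not below `Q` has `j` as its only point outside `Q`, so different
-- `j` get different members.
covered⇒∣∁∣≤ : ∀ (Q : Subset n) → ¬ Yes H Q → (∀ j → j ∉ Q → Yes H (Q ∪ ⁅ j ⁆)) → ∣ ∁ Q ∣ ≤ length H
covered⇒∣∁∣≤ {n} {H} Q noQ cover = subst (_≤ length H) (length-elements (∁ Q))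
  (injection⇒length≤ R R-inj (elements-unique (∁ Q)) choose)
  where
  R : Fin n → Subset n → Set
  R j T = j ∉ Q × j ∈ T × T ⊆ Q ∪ ⁅ j ⁆
  R-inj : ∀ {j l T} → R j T → R l T → j ≡ l
  R-inj (j∉Q , j∈T , _) (_ , _ , T⊆) with ∈-adjoin⁻ (T⊆ j∈T)
  ... | inj₁ j∈Q = contradiction j∈Q j∉Q
  ... | inj₂ j≡l = j≡l
  choose : ∀ {j} → j ∈ₗ elements (∁ Q) → ∃ λ T → T ∈ₗ H × R j T
  choose {j} j∈ with j∉Q ← x∈∁p⇒x∉p (∈-elements⁻ j∈)
    with T , T∈H , T⊆ ← find (cover j j∉Q)
    with y , y∈T , y∉Q ← ⊈⇒∃ (λ T⊆Q → noQ (lose T∈H T⊆Q))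
    with ∈-adjoin⁻ (T⊆ y∈T)
  ... | inj₁ y∈Q  = contradiction y∈Q y∉Q
  ... | inj₂ refl = T , T∈H , j∉Q , y∈T , T⊆

-- Induction on the number of points missing from `Q`, bounded by `d`. With at most `k` missing, `Q`
-- is full or in a layer. With more, the induction gives YES for `H′` on every `Q ∪ ⁅ j ⁆`, and by
-- `covered⇒∣∁∣≤` a NO on `Q` would leave at most `k` missing.
layers-dominate : ∀ (i₀ : Fin n) → 2 ≤ k → k ≤ n → length H′ ≡ k →
  (∀ {Q} → Q ∈ₗ layers n k → Q ≢ co i₀ → Yes H Q → Yes H′ Q) →
  ∀ Q → Q ≢ co i₀ → Yes H Q → Yes H′ Q
layers-dominate {n} {k} {H′} {H} i₀ 2≤k k≤n len′ dom Q = go (∣ ∁ Q ∣) Q ≤-refl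
  where
  go : ∀ d Q → ∣ ∁ Q ∣ ≤ d → Q ≢ co i₀ → Yes H Q → Yes H′ Q
  go d Q ≤d Q≢ yesQ with ∣ ∁ Q ∣ ≤? k
  go d Q ≤d Q≢ yesQ | yes ∁≤k with Q ≟ₛ ⊤
  ... | yes refl = Yes⊤ (subst (1 ≤_) (sym len′) (<⇒≤ 2≤k))
  ... | no Q≢⊤ = dom (∈-layers⁺ k≤n Q lo (≤∧≢⇒< (∣p∣≤n Q) (λ eq → Q≢⊤ (∣p∣≡n⇒p≡⊤ eq)))) Q≢ yesQ
    where
    lo : n ∸ k ≤ ∣ Q ∣
    lo = m≤n+o⇒m∸n≤o n k (begin
      n                ≡⟨ ∣p∣+∣∁p∣≡n Q ⟨
      ∣ Q ∣ + ∣ ∁ Q ∣  ≤⟨ +-monoʳ-≤ ∣ Q ∣ ∁≤k ⟩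
      ∣ Q ∣ + k        ≡⟨ +-comm ∣ Q ∣ k ⟩
      k + ∣ Q ∣        ∎)
      where open ≤-Reasoning
  go zero Q ≤d Q≢ yesQ | no ∁≰k = contradiction (≤-trans ≤d z≤n) ∁≰k
  go (suc d) Q ≤d Q≢ yesQ | no ∁≰k = decidable-stable (Yes? H′ Q)
    (λ noQ → ∁≰k (subst (∣ ∁ Q ∣ ≤_) len′ (covered⇒∣∁∣≤ Q noQ cover)))
    where
    cover : ∀ j → j ∉ Q → Yes H′ (Q ∪ ⁅ j ⁆)
    cover j j∉Q = go d (Q ∪ ⁅ j ⁆)
      (≤-pred (≤-trans (p⊂q⇒∣p∣<∣q∣ (p⊂q⇒∁p⊃∁q (⊆-adjoin , j , ∈-adjoin Q j , j∉Q))) ≤d))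
      Qj≢co (Yes-mono ⊆-adjoin yesQ)
      where
      Qj≢co : Q ∪ ⁅ j ⁆ ≢ co i₀
      -- Otherwise at most `i₀` and `j` are missing from `Q`, and 2 ≤ `k`.
      Qj≢co eq = ∁≰k (≤-trans (subst (_≤ 2) (length-elements (∁ Q))
        (Unique-⊆⇒length≤ {bs = i₀ ∷ j ∷ []} (elements-unique (∁ Q)) two)) 2≤k)
        where
        two : ∀ {x} → x ∈ₗ elements (∁ Q) → x ∈ₗ i₀ ∷ j ∷ []
        two {x} x∈ with x Fin.≟ i₀
        ... | yes x≡i₀ = here x≡i₀
        ... | no x≢i₀ with ∈-adjoin⁻ (subst (x ∈_) (sym eq) (∈-co⁺ x≢i₀))
        ...   | inj₁ x∈Q = contradiction x∈Q (x∈∁p⇒x∉p (∈-elements⁻ x∈))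
        ...   | inj₂ x≡j = there (here x≡j)

-- If the up-sets differed only in co i, then H′ would be H without co i.
co-determined : ∀ (i : Fin n) → 2 ≤ k → IsAntichain H → length H ≡ k → IsAntichain H′ → length H′ ≡ k →
  (∀ P → P ≢ co i → Yes H P → Yes H′ P) → (∀ P → P ≢ co i → Yes H′ P → Yes H P) →
  Yes H (co i) → Yes H′ (co i)
co-determined {n} {k} {H} {H′} i 2≤k anti len anti′ len′ f g yes-co =
  decidable-stable (Yes? H′ (co i)) impossible
  where
  impossible : ¬ ¬ Yes H′ (co i)
  impossible no-co = 1+n≰n (subst₂ _≤_ (cong suc len′) len
    (Unique-⊆⇒length≤ (All.tabulate (λ T∈ → λ { refl → no-co (lose T∈ id) }) ∷ antichain-unique anti′) included))
    where
    H⇒H′ : ∀ {S} → S ∈ₗ H → S ≢ co i → S ∈ₗ H′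
    H⇒H′ S∈ S≢ = minimal-transfer anti S∈ (f _ S≢ (lose S∈ id))
      (λ q _ yesq → g q (λ { refl → no-co yesq }) yesq)
    H′⇒H : ∀ {T} → T ∈ₗ H′ → T ∈ₗ H
    H′⇒H {T} T∈ with S , S∈ , S⊆T ← find (g T (λ { refl → no-co (lose T∈ id) }) (lose T∈ id)) with S ≟ₛ co i
    ... | no S≢ = subst (_∈ₗ H) (antichain-≡ anti′ (H⇒H′ S∈ S≢) T∈ S⊆T) S∈
    -- Here `T` lies properly above `co i`, so it is full and would contain another member of `H′`.
    ... | yes refl with i∈T ← co⊆∧≢⇒∋ S⊆T (λ { refl → no-co (lose T∈ id) })
      with R , R∈ , R≢T ← antichain-other anti′ (subst (2 ≤_) (sym len′) 2≤k) T =
        contradiction (antichain-≡ anti′ R∈ T∈ (λ _ → co⊆∧∋⇒⊤⊆ S⊆T i∈T ∈⊤)) R≢T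
    co∈H : co i ∈ₗ H
    co∈H with S , S∈ , S⊆co ← find yes-co with S ≟ₛ co i
    ... | yes refl = S∈
    ... | no S≢    = ⊥-elim (no-co (lose (H⇒H′ S∈ S≢) S⊆co))
    included : ∀ {S} → S ∈ₗ co i ∷ H′ → S ∈ₗ H
    included (here refl) = co∈H
    included (there T∈)  = H′⇒H T∈

-- If ⁅ a ⁆ were only in the up-set of H, then H′ would be H without ⁅ a ⁆ plus one further set,
-- so at most one member of H′ would contain a; having a member below each ⁅ a ⁆ ∪ ⁅ x ⁆,
-- H′ would consist of such members only and have size less than n.
singleton-determined : ∀ (i a : Fin n) → a ≢ i → (∀ x → ⁅ a ⁆ ∪ ⁅ x ⁆ ≢ co i) → 2 ≤ k → n ≤ k →
  IsAntichain H → length H ≡ k → IsAntichain H′ → length H′ ≡ k →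
  (∀ P → P ≢ co i → P ≢ ⁅ a ⁆ → Yes H P → Yes H′ P) → (∀ P → P ≢ co i → P ≢ ⁅ a ⁆ → Yes H′ P → Yes H P) →
  Yes H ⁅ a ⁆ → Yes H′ ⁅ a ⁆
singleton-determined {n} {k} {H} {H′} i a a≢i edge≢co 2≤k n≤k anti len anti′ len′ f g yes-a =
  decidable-stable (Yes? H′ ⁅ a ⁆) impossible
  where
  impossible : ¬ ¬ Yes H′ ⁅ a ⁆
  impossible no-a = 1+n≰n (≤-trans (s≤s bound) (subst (_≤ k) (sym rest-length) n≤k))
    where
    a∈H : ⁅ a ⁆ ∈ₗ H
    a∈H with S , S∈ , S⊆a ← find yes-a
      with x , x∈S , _ ← ⊈⇒∃ {q = ⊥} (λ S⊆⊥ → ¬Yes⊥ anti (subst (2 ≤_) (sym len) 2≤k) (lose S∈ S⊆⊥))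
      with refl ← x∈⁅y⁆⇒x≡y a (S⊆a x∈S)
      with refl ← ⊆-antisym S⊆a (⁅⁆-⊆ x∈S) = S∈
    a∉ : ∀ {S} → S ∈ₗ H → S ≢ ⁅ a ⁆ → a ∉ S
    a∉ S∈ S≢ a∈S = S≢ (sym (antichain-≡ anti a∈H S∈ (⁅⁆-⊆ a∈S)))
    ∌a⇒≢ : ∀ {S} → a ∉ S → S ≢ co i × S ≢ ⁅ a ⁆
    ∌a⇒≢ a∉S = (λ { refl → a∉S (∈-co⁺ a≢i) }) , (λ { refl → a∉S (x∈⁅x⁆ a) })
    H⇒H′ : ∀ {S} → S ∈ₗ H → S ≢ ⁅ a ⁆ → S ∈ₗ H′
    H⇒H′ S∈ S≢ = minimal-transfer anti S∈ (f _ (proj₁ (∌a⇒≢ a∉S)) S≢ (lose S∈ id))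
      (λ q q⊆S → g q (proj₁ (∌a⇒≢ (λ a∈q → a∉S (q⊆S a∈q)))) (proj₂ (∌a⇒≢ (λ a∈q → a∉S (q⊆S a∈q)))))
      where a∉S = a∉ S∈ S≢
    -- The k - 1 members of `H` other than `⁅ a ⁆` avoid `a` and belong to `H′`; two further members
    -- containing `a` would make k + 1.
    one-∋a : ∀ {S T} → S ∈ₗ H′ → T ∈ₗ H′ → a ∈ S → a ∈ T → S ≡ T
    one-∋a {S} {T} S∈ T∈ a∈S a∈T = decidable-stable (S ≟ₛ T) (λ S≢T → 1+n≰n
      (subst₂ _≤_ (cong suc (trans (length-remove (antichain-unique anti) a∈H) len)) len′
        (Unique-⊆⇒length≤ {as = S ∷ T ∷ remove ⁅ a ⁆ H} ((S≢T ∷ fresh a∈S) ∷ fresh a∈T ∷ remove-unique ⁅ a ⁆ (antichain-unique anti)) incl)))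
      where
      fresh : ∀ {R} → a ∈ R → All (R ≢_) (remove ⁅ a ⁆ H)
      fresh a∈R = All.tabulate (λ P∈ → λ { refl → a∉ (proj₁ (∈-remove⁻ P∈)) (proj₂ (∈-remove⁻ {as = H} P∈)) a∈R })
      incl : ∀ {R} → R ∈ₗ S ∷ T ∷ remove ⁅ a ⁆ H → R ∈ₗ H′
      incl (here refl)         = S∈
      incl (there (here refl)) = T∈
      incl (there (there R∈)) with R∈H , R≢ ← ∈-remove⁻ R∈ = H⇒H′ R∈H R≢
    ∃≢a : ∀ {T} → T ∈ₗ H′ → ∃ λ x → x ∈ T × x ≢ a
    ∃≢a T∈ with x , x∈T , x∉ ← ⊈⇒∃ (λ T⊆a → no-a (lose T∈ T⊆a)) = x , x∈T , x∉⁅y⁆⇒x≢y x∉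
    edge : ∀ x → x ≢ a → ∃ λ T → T ∈ₗ H′ × x ∈ T × T ⊆ ⁅ a ⁆ ∪ ⁅ x ⁆
    edge x x≢a
      with T , T∈ , T⊆ ← find (f (⁅ a ⁆ ∪ ⁅ x ⁆) (edge≢co x)
             (λ eq → x≢a (x∈⁅y⁆⇒x≡y a (subst (x ∈_) eq (∈-adjoin ⁅ a ⁆ x)))) (lose a∈H ⊆-adjoin))
      with y , y∈T , y≢a ← ∃≢a T∈
      with ∈-adjoin⁻ (T⊆ y∈T)
    ... | inj₁ y∈a  = contradiction (x∈⁅y⁆⇒x≡y a y∈a) y≢a
    ... | inj₂ refl = T , T∈ , y∈T , T⊆
    -- If `E` avoided `a` it would lie inside `⁅ x ⁆`, hence below `T`, and so equal `T`, which
    -- contains `y`.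
    edge∋a : ∀ {T x y} → T ∈ₗ H′ → x ∈ T → y ∈ T → y ≢ a → y ≢ x → ∀ {E} → E ∈ₗ H′ → E ⊆ ⁅ a ⁆ ∪ ⁅ x ⁆ → a ∈ E
    edge∋a {T} {x} {y} T∈ x∈T y∈T y≢a y≢x {E} E∈ E⊆ = decidable-stable (a ∈? E) λ a∉E →
      [ (λ y∈a → y≢a (x∈⁅y⁆⇒x≡y a y∈a)) , y≢x ]′ (∈-adjoin⁻ (E⊆ (subst (y ∈_) (sym (antichain-≡ anti′ E∈ T∈
        (λ z∈E → [ (λ z∈a → contradiction (subst (_∈ E) (x∈⁅y⁆⇒x≡y a z∈a) z∈E) a∉E) , (λ { refl → x∈T }) ]′ (∈-adjoin⁻ (E⊆ z∈E))))) y∈T)))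
    R : Subset n → Fin n → Set
    R T x = T ∈ₗ H′ × x ∈ T × T ⊆ ⁅ a ⁆ ∪ ⁅ x ⁆
    -- A set related to `x` is `⁅ x ⁆` or the pair of `a` and `x`; these are comparable, so `H′`
    -- contains at most one of them.
    R-inj : ∀ {S T x} → R S x → R T x → S ≡ T
    R-inj {S} {T} (S∈ , x∈S , S⊆) (T∈ , x∈T , T⊆) with a ∈? S
    ... | yes a∈S = sym (antichain-≡ anti′ T∈ S∈ (λ z∈T → adjoin-⊆ (⁅⁆-⊆ a∈S) x∈S (T⊆ z∈T)))
    ... | no a∉S  = antichain-≡ anti′ S∈ T∈ (λ z∈S →
      [ (λ z∈a → contradiction (subst (_∈ S) (x∈⁅y⁆⇒x≡y a z∈a) z∈S) a∉S) , (λ { refl → x∈T }) ]′ (∈-adjoin⁻ (S⊆ z∈S)))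
    rest : List (Fin n)
    rest = removeᶠ a (allFin n)
    rest-length : suc (length rest) ≡ n
    rest-length = trans (length-removeᶠ (Unique.allFin⁺ n) (∈-allFin a)) (length-tabulate {n = n} id)
    choose : ∀ {T} → T ∈ₗ H′ → ∃ λ x → x ∈ₗ rest × R T x
    choose {T} T∈ with x , x∈T , x≢a ← ∃≢a T∈ with T ⊆? ⁅ a ⁆ ∪ ⁅ x ⁆
    ... | yes T⊆ = x , ∈-removeᶠ⁺ (∈-allFin x) x≢a , T∈ , x∈T , T⊆
    -- A third point `y` of `T` gives members below the pairs of `a` with `x` and of `a` with `y`.
    -- Both contain `a`, so they coincide, although `x` is not in the second pair.
    ... | no T⊈ with y , y∈T , y∉ ← ⊈⇒∃ T⊈
      with y≢x ← (λ (y≡x : y ≡ x) → y∉ (subst (_∈ _) (sym y≡x) (∈-adjoin ⁅ a ⁆ x)))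
      with y≢a ← (λ (y≡a : y ≡ a) → y∉ (subst (_∈ _) (sym y≡a) (⊆-adjoin (x∈⁅x⁆ a))))
      with E , E∈ , x∈E , E⊆ ← edge x x≢a | E′ , E′∈ , y∈E′ , E′⊆ ← edge y y≢a
      with refl ← one-∋a E∈ E′∈ (edge∋a T∈ x∈T y∈T y≢a y≢x E∈ E⊆) (edge∋a T∈ y∈T x∈T x≢a (y≢x ∘ sym) E′∈ E′⊆) =
        contradiction (∈-adjoin⁻ (E′⊆ x∈E)) [ (λ x∈a → x≢a (x∈⁅y⁆⇒x≡y a x∈a)) , (λ x≡y → y≢x (sym x≡y)) ]′
    bound : k ≤ length rest
    bound = subst (_≤ length rest) len′ (injection⇒length≤ R R-inj (antichain-unique anti′) choose)

-- Antichains from the middle layer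

-- `Z` is placed on the points other than `i` and `j`, with side `s` at `i` and `t` at `j`;
-- `punchOut i≢j` is the position of `j` once `i` is deleted.
insert₂ : ∀ {m} {i j : Fin (2 + m)} → i ≢ j → Side → Side → Subset m → Subset (2 + m)
insert₂ {i = i} i≢j s t Z = insertAt (insertAt Z (punchOut i≢j) t) i s

punchIn₂ : ∀ {m} {i j : Fin (2 + m)} → i ≢ j → Fin m → Fin (2 + m)
punchIn₂ {i = i} i≢j x = punchIn i (punchIn (punchOut i≢j) x)

module _ {m} {i j : Fin (2 + m)} (i≢j : i ≢ j) where

  punchIn₂-injective : ∀ {x y} → punchIn₂ i≢j x ≡ punchIn₂ i≢j y → x ≡ y
  punchIn₂-injective eq = Fin.punchIn-injective (punchOut i≢j) _ _ (Fin.punchIn-injective i _ _ eq)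

  punchIn₂≢ˡ : ∀ x → punchIn₂ i≢j x ≢ i
  punchIn₂≢ˡ x = Fin.punchInᵢ≢i i _

  punchIn₂≢ʳ : ∀ x → punchIn₂ i≢j x ≢ j
  punchIn₂≢ʳ x eq = Fin.punchInᵢ≢i (punchOut i≢j) x
    (Fin.punchIn-injective i _ _ (trans eq (sym (Fin.punchIn-punchOut i≢j))))

  module _ (s t : Side) (Z : Subset m) where

    lookup-insert₂ˡ : lookup (insert₂ i≢j s t Z) i ≡ s
    lookup-insert₂ˡ = insertAt-lookup _ i s

    lookup-insert₂ʳ : lookup (insert₂ i≢j s t Z) j ≡ t
    lookup-insert₂ʳ = subst (λ l → lookup (insert₂ i≢j s t Z) l ≡ t) (Fin.punchIn-punchOut i≢j)
      (trans (insertAt-punchIn _ i s (punchOut i≢j)) (insertAt-lookup Z (punchOut i≢j) t))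

    lookup-insert₂ : ∀ x → lookup (insert₂ i≢j s t Z) (punchIn₂ i≢j x) ≡ lookup Z x
    lookup-insert₂ x = trans (insertAt-punchIn _ i s _) (insertAt-punchIn Z (punchOut i≢j) t x)

    ∈-insert₂⁺ : ∀ {x} → x ∈ Z → punchIn₂ i≢j x ∈ insert₂ i≢j s t Z
    ∈-insert₂⁺ {x} x∈Z = lookup⇒[]= _ _ (trans (lookup-insert₂ x) ([]=⇒lookup x∈Z))

    ∈-insert₂⁻ : ∀ {x} → punchIn₂ i≢j x ∈ insert₂ i≢j s t Z → x ∈ Z
    ∈-insert₂⁻ {x} x∈ = lookup⇒[]= _ _ (trans (sym (lookup-insert₂ x)) ([]=⇒lookup x∈))

  -- Equal sizes make the copies of `r`-element sets incomparable, whatever the common sides at `i`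
  -- and `j`. This supplies the padding for large `k`, and its supply `m C r` is where the upper
  -- limit on `k` enters.
  middle-antichain : ∀ s t r N → N ≤ m C r → Σ (Family (2 + m)) λ F →
    IsAntichain F × length F ≡ N × (∀ {Y} → Y ∈ₗ F → ∃ λ Z → ∣ Z ∣ ≡ r × Y ≡ insert₂ i≢j s t Z)
  middle-antichain s t r N N≤ = map (insert₂ i≢j s t) (take N (layer m r)) ,
    map-antichain _ (Unique.take⁺ N (layer-unique m r)) inj ,
    trans (length-map _ (take N (layer m r))) (trans (length-take N (layer m r))
      (m≤n⇒m⊓n≡m (subst (N ≤_) (sym (length-layer m r)) N≤))) ,
    (λ Y∈ → let Z , Z∈ , eq = ∈-map⁻ _ Y∈ in Z , ∈-layer⁻ m r (∈-take N Z∈) , eq)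
    where
    inj : ∀ {Z W} → Z ∈ₗ take N (layer m r) → W ∈ₗ take N (layer m r) → insert₂ i≢j s t Z ⊆ insert₂ i≢j s t W → Z ≡ W
    inj {Z} {W} Z∈ W∈ sub = decidable-stable (Z ≟ₛ W) λ Z≢W →
      <-irrefl (trans (∈-layer⁻ m r (∈-take N Z∈)) (sym (∈-layer⁻ m r (∈-take N W∈))))
        (⊆∧≢⇒∣∣< {p = Z} (λ x∈Z → ∈-insert₂⁻ s t W (sub (∈-insert₂⁺ s t Z x∈Z))) (Z≢W ∘ sym))

inside-∈ : lookup p x ≡ inside → x ∈ p
inside-∈ = lookup⇒[]= _ _

outside-∉ : lookup p x ≡ outside → x ∉ p
outside-∉ eq x∈p with () ← trans (sym eq) ([]=⇒lookup x∈p)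

-- Sizes and missing points

∣co∣ : ∀ (i : Fin n) → ∣ co i ∣ ≡ n ∸ 1
∣co∣ {n} i = trans (∣∁p∣≡n∸∣p∣ ⁅ i ⁆) (cong (n ∸_) (∣⁅x⁆∣≡1 i))

co-injective : co x ≡ co y → x ≡ y
co-injective {x = x} {y} eq = decidable-stable (x Fin.≟ y) (λ x≢y → ∈-co⁻ (subst (x ∈_) (sym eq) (∈-co⁺ x≢y)) refl)

≢⊤⇒∃∉ : p ≢ ⊤ → ∃ λ x → x ∉ p
≢⊤⇒∃∉ p≢⊤ with x , _ , x∉p ← ⊆∧≢⇒∃ ⊆⊤ (p≢⊤ ∘ sym) = x , x∉p

≢co⇒∃∉ : x ∉ p → p ≢ co x → ∃ λ y → y ∉ p × y ≢ x
≢co⇒∃∉ {x = x} {p} x∉p p≢co with y , y∈co , y∉p ← ⊆∧≢⇒∃ {p = p} {co x} (λ y∈p → ∈-co⁺ (λ { refl → x∉p y∈p })) (p≢co ∘ sym) =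
  y , y∉p , ∈-co⁻ y∈co

-- The case k = 1

-- For a single set `S` the answer on `co x` is YES exactly when `x` is not in `S`, so these n
-- queries read off `S`.
h-one : ∀ n → hIs n 1 n
h-one n =
  (map co (allFin n) , Unique.map⁺ co-injective (Unique.allFin⁺ n) ,
    trans (length-map co (allFin n)) (length-tabulate {n = n} id) , separating-intro _ same) , lower
  where
  dominate : ∀ (S T : Subset n) → (∀ {Q} → Q ∈ₗ map co (allFin n) → Yes (S ∷ []) Q → Yes (T ∷ []) Q) →
    ∀ P → Yes (S ∷ []) P → Yes (T ∷ []) P
  dominate S T f P (here S⊆P) = here λ {x} x∈T → decidable-stable (x ∈? P) λ x∉P →
    avoid x∈T (f (∈-map⁺ co (∈-allFin x)) (here (λ y∈S → ∈-co⁺ (λ { refl → x∉P (S⊆P y∈S) }))))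
    where
    avoid : ∀ {x} → x ∈ T → ¬ Yes (T ∷ []) (co x)
    avoid x∈T (here T⊆co) = ∈-co⁻ (T⊆co x∈T) refl
  same : ∀ {H H′} → IsAntichain H → length H ≡ 1 → IsAntichain H′ → length H′ ≡ 1 →
    (∀ {Q} → Q ∈ₗ map co (allFin n) → Yes H Q → Yes H′ Q) → (∀ {Q} → Q ∈ₗ map co (allFin n) → Yes H′ Q → Yes H Q) → SameFamily H H′
  same {S ∷ []} {T ∷ []} anti refl anti′ refl f g = Yes-determines anti anti′ (dominate S T f) (dominate T S g)
  lower : ∀ (G : Family n) → Unique G → Separating n 1 G → n ≤ length G
  lower G _ sep = subst (_≤ length G) (trans (length-map co (allFin n)) (length-tabulate {n = n} id))
    (Unique-⊆⇒length≤ (Unique.map⁺ co-injective (Unique.allFin⁺ n)) included)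
    where
    co∈G : ∀ i → co i ∈ₗ G
    -- The inferred antichains are `co i ∷ []` and `⊤ ∷ []`, which are told apart by `co i` alone.
    co∈G i = [ id , id ]′ (separating-hits sep ([] ∷ []) refl ([] ∷ []) refl (co i) (co i)
      (λ { P P≢ (here co⊆P) → here (co⊆∧∋⇒⊤⊆ co⊆P (co⊆∧≢⇒∋ co⊆P P≢)) })
      (λ { P P≢ (here ⊤⊆P) → here (λ _ → ⊤⊆P ∈⊤) })
      (here id) (λ { (here ⊤⊆co) → ∈-co⁻ (⊤⊆co (∈⊤ {x = i})) refl }))
    included : ∀ {P} → P ∈ₗ map co (allFin n) → P ∈ₗ G
    included P∈ with i , _ , refl ← ∈-map⁻ co P∈ = co∈G i

-- The case 1 < k < n

module Small {n k : ℕ} (1<k : 1 < k) (k<n : k < n) where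

  k≤n : k ≤ n
  k≤n = <⇒≤ k<n

  -- The omitted complement is a parameter: the lower bound compares `G` with the family for the
  -- exception that `G` itself determines, and the length is the same for all of them.
  family : Fin n → Family n
  family i₀ = remove (co i₀) (layers n k)

  family-unique : ∀ i₀ → Unique (family i₀)
  family-unique i₀ = remove-unique (co i₀) (layers-unique n k)

  length-family : ∀ i₀ → length (family i₀) ≡ binomSum n k ∸ 1
  length-family i₀ = trans (cong (_∸ 1) (length-remove (layers-unique n k) co∈)) (cong (_∸ 1) (length-layers n k))
    where
    co∈ : co i₀ ∈ₗ layers n k
    co∈ = ∈-layers⁺ k≤n (co i₀) (subst (n ∸ k ≤_) (sym (∣co∣ i₀)) (∸-monoʳ-≤ n (<⇒≤ 1<k)))
      (subst (_< n) (sym (∣co∣ i₀)) (∸-monoʳ-< {n} (s≤s z≤n) (≤-trans (<⇒≤ 1<k) k≤n)))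

  separating : ∀ i₀ → Separating n k (family i₀)
  separating i₀ = separating-intro (family i₀) same
    where
    same : ∀ {H H′} → IsAntichain H → length H ≡ k → IsAntichain H′ → length H′ ≡ k →
      (∀ {Q} → Q ∈ₗ family i₀ → Yes H Q → Yes H′ Q) → (∀ {Q} → Q ∈ₗ family i₀ → Yes H′ Q → Yes H Q) → SameFamily H H′
    same {H} {H′} anti len anti′ len′ f g = Yes-determines anti anti′ f″ g″
      where
      f′ = layers-dominate {H′ = H′} {H} i₀ 1<k k≤n len′ (λ Q∈ Q≢ → f (∈-remove⁺ Q∈ Q≢))
      g′ = layers-dominate {H′ = H} {H′} i₀ 1<k k≤n len (λ Q∈ Q≢ → g (∈-remove⁺ Q∈ Q≢))
      f″ : ∀ P → Yes H P → Yes H′ P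
      f″ P with P ≟ₛ co i₀
      ... | yes refl = co-determined i₀ 1<k anti len anti′ len′ f′ g′
      ... | no P≢    = f′ P P≢
      g″ : ∀ P → Yes H′ P → Yes H P
      g″ P with P ≟ₛ co i₀
      ... | yes refl = co-determined i₀ 1<k anti′ len′ anti len g′ f′
      ... | no P≢    = g′ P P≢

  module _ {G : Family n} (sep : Separating n k G) where

    -- The padding is k - 1 of the n - 2 other complements `co x`, enough because k < n.
    co-pair : ∀ i j → i ≢ j → co i ∈ₗ G ⊎ co j ∈ₗ G
    co-pair i j i≢j = top-pair sep i≢j (map-antichain co (Unique.take⁺ (k ∸ 1) K-unique) co-inj) F-length good
      where
      K : List (Fin n)
      K = removeᶠ j (removeᶠ i (allFin n))
      K-unique : Unique K
      K-unique = removeᶠ-unique j (removeᶠ-unique i (Unique.allFin⁺ n))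
      K-length : 2 + length K ≡ n
      K-length = trans (cong suc (length-removeᶠ (removeᶠ-unique i (Unique.allFin⁺ n)) (∈-removeᶠ⁺ (∈-allFin j) (i≢j ∘ sym))))
        (trans (length-removeᶠ (Unique.allFin⁺ n) (∈-allFin i)) (length-tabulate {n = n} id))
      F-length : suc (length (map co (take (k ∸ 1) K))) ≡ k
      F-length = trans (cong suc (trans (length-map co (take (k ∸ 1) K)) (trans (length-take (k ∸ 1) K)
        (m≤n⇒m⊓n≡m (∸-monoˡ-≤ 1 (≤-pred (subst (suc k ≤_) (sym K-length) k<n)))))))
        (m+[n∸m]≡n (<⇒≤ 1<k))
      co-inj : ∀ {x y} → x ∈ₗ take (k ∸ 1) K → y ∈ₗ take (k ∸ 1) K → co x ⊆ co y → x ≡ y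
      co-inj {x} {y} _ _ sub = decidable-stable (x Fin.≟ y) (λ x≢y → ∈-co⁻ (sub (∈-co⁺ (x≢y ∘ sym))) refl)
      good : ∀ {Y} → Y ∈ₗ map co (take (k ∸ 1) K) → i ∈ Y × j ∈ Y × ¬ ⊤ ⊆ Y
      good Y∈ with x , x∈ , refl ← ∈-map⁻ co Y∈
        with x∈′ , x≢j ← ∈-removeᶠ⁻ (∈-take (k ∸ 1) x∈)
        with _ , x≢i ← ∈-removeᶠ⁻ {as = allFin n} x∈′ =
          ∈-co⁺ (x≢i ∘ sym) , ∈-co⁺ (x≢j ∘ sym) , (λ ⊤⊆co → ∈-co⁻ (⊤⊆co (∈⊤ {x = x})) refl)

    -- `forced` with `A` as `Q` without `x₀`; the padding sets replace another point `x` of `Q` by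
    -- `j`. Each contains `x₀` but not `x`, the reverse of every petal. There are |Q| - 1 choices of
    -- `x`, and k < n makes them suffice.
    inner∈G : ∀ Q → n ∸ k ≤ ∣ Q ∣ → ∀ {i j} → i ∉ Q → j ∉ Q → j ≢ i → Q ∈ₗ G
    inner∈G Q lo {i} {j} i∉Q j∉Q j≢i
      with x₀ , x₀∈Q ← ∣p∣≥1⇒∃ Q (≤-trans (m<n⇒0<n∸m k<n) lo) =
        forced sep i∉Q (p∩q⊆p Q (co x₀)) (λ Q⊆A → ∉punctured (Q⊆A x₀∈Q))
          (map-antichain Y (Unique.take⁺ N K-unique) Y-inj) Ys-length good
      where
      ∉punctured : ∀ {x} → x ∉ Q ∩ co x
      ∉punctured {x} x∈ = ∈-co⁻ (proj₂ (x∈p∩q⁻ Q (co x) x∈)) refl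
      ∈punctured : ∀ {x y} → y ∈ Q → y ≢ x → y ∈ Q ∩ co x
      ∈punctured y∈Q y≢x = x∈p∩q⁺ (y∈Q , ∈-co⁺ y≢x)
      Y : Fin n → Subset n
      Y x = (Q ∩ co x) ∪ ⁅ j ⁆
      ∉Y : ∀ {x} → x ∈ Q → x ∉ Y x
      ∉Y x∈Q x∈Y with ∈-adjoin⁻ x∈Y
      ... | inj₁ x∈  = ∉punctured x∈
      ... | inj₂ refl = j∉Q x∈Q
      N : ℕ
      N = k ∸ ∣ ∁ Q ∣
      K : List (Fin n)
      K = removeᶠ x₀ (elements Q)
      K-unique : Unique K
      K-unique = removeᶠ-unique x₀ (elements-unique Q)
      K⇒ : ∀ {x} → x ∈ₗ take N K → x ∈ Q × x ≢ x₀
      K⇒ x∈ with x∈′ , x≢ ← ∈-removeᶠ⁻ (∈-take N x∈) = ∈-elements⁻ x∈′ , x≢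
      Y-inj : ∀ {x y} → x ∈ₗ take N K → y ∈ₗ take N K → Y x ⊆ Y y → x ≡ y
      Y-inj {x} {y} x∈ y∈ sub = decidable-stable (x Fin.≟ y) λ x≢y →
        ∉Y (proj₁ (K⇒ y∈)) (sub (⊆-adjoin (∈punctured (proj₁ (K⇒ y∈)) (x≢y ∘ sym))))
      ∁≤k : ∣ ∁ Q ∣ ≤ k
      ∁≤k = subst (_≤ k) (sym (∣∁p∣≡n∸∣p∣ Q)) (≤-trans (∸-monoʳ-≤ n lo) (≤-reflexive (m∸[m∸n]≡n k≤n)))
      N≤ : N ≤ length K
      N≤ = m≤n+o⇒m∸n≤o k ∣ ∁ Q ∣ (≤-pred (begin
        suc k                           ≤⟨ k<n ⟩
        n                               ≡⟨ ∣p∣+∣∁p∣≡n Q ⟨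
        ∣ Q ∣ + ∣ ∁ Q ∣                 ≡⟨ cong (_+ ∣ ∁ Q ∣) (length-elements Q) ⟨
        length (elements Q) + ∣ ∁ Q ∣   ≡⟨ cong (_+ ∣ ∁ Q ∣) (length-removeᶠ (elements-unique Q) (∈-elements⁺ x₀∈Q)) ⟨
        suc (length K) + ∣ ∁ Q ∣        ≡⟨ cong suc (+-comm (length K) ∣ ∁ Q ∣) ⟩
        suc (∣ ∁ Q ∣ + length K)        ∎))
        where open ≤-Reasoning
      Ys-length : ∣ ∁ Q ∣ + length (map Y (take N K)) ≡ k
      Ys-length = trans (cong (∣ ∁ Q ∣ +_) (trans (length-map Y (take N K)) (trans (length-take N K) (m≤n⇒m⊓n≡m N≤)))) (m+[n∸m]≡n ∁≤k)
      good : ∀ {P} → P ∈ₗ map Y (take N K) →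
        ¬ P ⊆ Q ∪ ⁅ i ⁆ × ¬ Q ⊆ P × (∀ {l} → l ∉ Q → l ≢ i → Incomparable ((Q ∩ co x₀) ∪ ⁅ l ⁆) P)
      good P∈ with x , x∈ , refl ← ∈-map⁻ Y P∈ with x∈Q , x≢x₀ ← K⇒ x∈ =
        (λ sub → [ j∉Q , j≢i ]′ (∈-adjoin⁻ (sub (∈-adjoin (Q ∩ co x) j)))) ,
        (λ sub → ∉Y x∈Q (sub x∈Q)) ,
        (λ {l} l∉Q l≢i →
          (λ sub → ∉Y x∈Q (sub (⊆-adjoin (∈punctured x∈Q x≢x₀)))) ,
          (λ sub → [ ∉punctured , (λ { refl → l∉Q x₀∈Q }) ]′
            (∈-adjoin⁻ (sub (⊆-adjoin (∈punctured x₀∈Q (x≢x₀ ∘ sym)))))))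

    family⊆G : ∀ {i₀} → (∀ i → i ≢ i₀ → co i ∈ₗ G) → ∀ {Q} → Q ∈ₗ family i₀ → Q ∈ₗ G
    family⊆G {i₀} cos {Q} Q∈ with Q∈layers , Q≢ ← ∈-remove⁻ Q∈
      with lo , hi ← ∈-layers⁻ k≤n Q∈layers
      with i , i∉Q ← ≢⊤⇒∃∉ {p = Q} (λ { refl → <-irrefl (∣⊤∣≡n n) hi })
      with Q ≟ₛ co i
    ... | yes refl = cos i (λ { refl → Q≢ refl })
    ... | no Q≢co with j , j∉Q , j≢i ← ≢co⇒∃∉ i∉Q Q≢co = inner∈G Q lo i∉Q j∉Q j≢i

  h-small : Fin n → hIs n k (binomSum n k ∸ 1)
  h-small z = (family z , family-unique z , length-family z , separating z) , lower
    where
    lower : ∀ (G : Family n) → Unique G → Separating n k G → binomSum n k ∸ 1 ≤ length G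
    lower G _ sep with i₀ , cos ← ∃-all-but-one co G z (co-pair sep) =
      subst (_≤ length G) (length-family i₀) (Unique-⊆⇒length≤ (family-unique i₀) (family⊆G sep cos))

-- The case n ≤ k

module Large {m k : ℕ} (4≤m : 4 ≤ m) (n≤k : 2 + m ≤ k) (k≤ : k ≤ m C ⌊ m /2⌋ + 1) where

  r : ℕ
  r = ⌊ m /2⌋

  2≤k : 2 ≤ k
  2≤k = ≤-trans (s≤s (s≤s z≤n)) n≤k

  2≤r : 2 ≤ r
  2≤r = ⌊n/2⌋-mono 4≤m

  r<m : r < m
  r<m = subst (λ l → ⌊ l /2⌋ < l) (m+[n∸m]≡n (≤-trans (s≤s z≤n) 4≤m)) (⌊n/2⌋<n (m ∸ 1))

  -- As soon as one member of the antichain is prescribed, the middle layer can supply all the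
  -- others.
  k∸≤ : ∀ {c} → 1 ≤ c → k ∸ c ≤ m C r
  k∸≤ 1≤c = ≤-trans (∸-monoʳ-≤ k 1≤c) (m≤n+o⇒m∸n≤o k 1 (≤-trans k≤ (≤-reflexive (+-comm (m C r) 1))))

  family : Fin (2 + m) → Fin (2 + m) → Family (2 + m)
  family i a = remove ⁅ a ⁆ (remove (co i) (remove ⊤ (remove ⊥ (subsets (2 + m)))))

  family-unique : ∀ i a → Unique (family i a)
  family-unique i a = remove-unique _ (remove-unique _ (remove-unique _ (remove-unique _ (subsets-unique (2 + m)))))

  ∣∣-≢ : ∀ {p q : Subset (2 + m)} {c d} → ∣ p ∣ ≡ c → ∣ q ∣ ≡ d → c ≢ d → p ≢ q
  ∣∣-≢ refl refl c≢d refl = c≢d refl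

  ∈-family⁺ : ∀ {i a Q} → Q ≢ ⊥ → Q ≢ ⊤ → Q ≢ co i → Q ≢ ⁅ a ⁆ → Q ∈ₗ family i a
  ∈-family⁺ {Q = Q} u v w x = ∈-remove⁺ (∈-remove⁺ (∈-remove⁺ (∈-remove⁺ (∈-subsets Q) u) v) w) x

  ∈-family⁻ : ∀ {i a Q} → Q ∈ₗ family i a → Q ≢ ⊥ × Q ≢ ⊤ × Q ≢ co i × Q ≢ ⁅ a ⁆
  ∈-family⁻ Q∈ with Q∈₁ , x ← ∈-remove⁻ Q∈ with Q∈₂ , w ← ∈-remove⁻ Q∈₁ with Q∈₃ , v ← ∈-remove⁻ Q∈₂
    with _ , u ← ∈-remove⁻ {as = subsets (2 + m)} Q∈₃ = u , v , w , x

  length-family : ∀ i a → length (family i a) ≡ 2 ^ (2 + m) ∸ 4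
  length-family i a = begin
    length (family i a)                        ≡⟨ drop U₃ a∈ ⟩
    length (remove (co i) (remove ⊤ (remove ⊥ (subsets (2 + m))))) ∸ 1  ≡⟨ cong (_∸ 1) (drop U₂ co∈) ⟩
    length (remove ⊤ (remove ⊥ (subsets (2 + m)))) ∸ 1 ∸ 1   ≡⟨ cong (λ l → l ∸ 1 ∸ 1) (drop U₁ ⊤∈) ⟩
    length (remove ⊥ (subsets (2 + m))) ∸ 1 ∸ 1 ∸ 1  ≡⟨ cong (λ l → l ∸ 1 ∸ 1 ∸ 1) (drop (subsets-unique (2 + m)) (∈-subsets ⊥)) ⟩
    length (subsets (2 + m)) ∸ 1 ∸ 1 ∸ 1 ∸ 1         ≡⟨ cong (λ l → l ∸ 1 ∸ 1 ∸ 1 ∸ 1) (length-subsets (2 + m)) ⟩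
    2 ^ (2 + m) ∸ 1 ∸ 1 ∸ 1 ∸ 1                      ≡⟨ ∸-+-assoc (2 ^ (2 + m) ∸ 1 ∸ 1) 1 1 ⟩
    2 ^ (2 + m) ∸ 1 ∸ 1 ∸ 2                          ≡⟨ ∸-+-assoc (2 ^ (2 + m) ∸ 1) 1 2 ⟩
    2 ^ (2 + m) ∸ 1 ∸ 3                              ≡⟨ ∸-+-assoc (2 ^ (2 + m)) 1 3 ⟩
    2 ^ (2 + m) ∸ 4                                  ∎
    where
    open ≡-Reasoning
    drop : ∀ {P L} → Unique L → P ∈ₗ L → length (remove P L) ≡ length L ∸ 1
    drop uniq P∈ = cong (_∸ 1) (length-remove uniq P∈)
    U₁ = remove-unique ⊥ (subsets-unique (2 + m))
    U₂ = remove-unique ⊤ U₁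
    U₃ = remove-unique (co i) U₂
    -- The four omitted sets have sizes 0, n, n - 1 and 1, pairwise distinct as n ≥ 6, so each
    -- removal drops exactly one set.
    ⊤∈ = ∈-remove⁺ (∈-subsets ⊤) (∣∣-≢ (∣⊤∣≡n (2 + m)) (∣⊥∣≡0 (2 + m)) λ ())
    co∈ = ∈-remove⁺ (∈-remove⁺ (∈-subsets (co i)) (∣∣-≢ (∣co∣ i) (∣⊥∣≡0 (2 + m)) λ ())) (∣∣-≢ (∣co∣ i) (∣⊤∣≡n (2 + m)) (<⇒≢ (n<1+n (suc m))))
    a∈ = ∈-remove⁺ (∈-remove⁺ (∈-remove⁺ (∈-subsets ⁅ a ⁆) (∣∣-≢ (∣⁅x⁆∣≡1 a) (∣⊥∣≡0 (2 + m)) λ ()))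
      (∣∣-≢ (∣⁅x⁆∣≡1 a) (∣⊤∣≡n (2 + m)) (λ ()))) (∣∣-≢ (∣⁅x⁆∣≡1 a) (∣co∣ i) (<⇒≢ (s≤s (≤-trans (s≤s z≤n) 4≤m))))

  -- Agreement is extended in stages: to the empty and full sets, where the answers are fixed, then
  -- to `⁅ a ⁆`, then to `co i`. The order matters, since `singleton-determined` tolerates
  -- disagreement at `co i` while `co-determined` assumes agreement everywhere else.
  separating : ∀ i a → a ≢ i → (∀ x → ⁅ a ⁆ ∪ ⁅ x ⁆ ≢ co i) → Separating (2 + m) k (family i a)
  separating i a a≢i edge≢co = separating-intro (family i a) same
    where
    Dominates : Family (2 + m) → Family (2 + m) → Set
    Dominates H H′ = ∀ {Q} → Q ∈ₗ family i a → Yes H Q → Yes H′ Q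
    step₁ : ∀ {H H′} → IsAntichain H → length H ≡ k → length H′ ≡ k → Dominates H H′ →
      ∀ P → P ≢ co i → P ≢ ⁅ a ⁆ → Yes H P → Yes H′ P
    step₁ anti len len′ f P P≢co P≢a with P ≟ₛ ⊥ | P ≟ₛ ⊤
    ... | yes refl | _        = λ y → contradiction y (¬Yes⊥ anti (subst (2 ≤_) (sym len) 2≤k))
    ... | no _     | yes refl = λ _ → Yes⊤ (subst (1 ≤_) (sym len′) (<⇒≤ 2≤k))
    ... | no P≢⊥   | no P≢⊤  = f (∈-family⁺ P≢⊥ P≢⊤ P≢co P≢a)
    step₂ : ∀ {H H′} → IsAntichain H → length H ≡ k → IsAntichain H′ → length H′ ≡ k → Dominates H H′ → Dominates H′ H →
      ∀ P → P ≢ co i → Yes H P → Yes H′ P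
    step₂ anti len anti′ len′ f g P P≢co with P ≟ₛ ⁅ a ⁆
    ... | yes refl = singleton-determined i a a≢i edge≢co 2≤k n≤k anti len anti′ len′ (step₁ anti len len′ f) (step₁ anti′ len′ len g)
    ... | no P≢a   = step₁ anti len len′ f P P≢co P≢a
    step₃ : ∀ {H H′} → IsAntichain H → length H ≡ k → IsAntichain H′ → length H′ ≡ k → Dominates H H′ → Dominates H′ H →
      ∀ P → Yes H P → Yes H′ P
    step₃ anti len anti′ len′ f g P with P ≟ₛ co i
    ... | yes refl = co-determined i 2≤k anti len anti′ len′ (step₂ anti len anti′ len′ f g) (step₂ anti′ len′ anti len g f)
    ... | no P≢co  = step₂ anti len anti′ len′ f g P P≢co
    same : ∀ {H H′} → IsAntichain H → length H ≡ k → IsAntichain H′ → length H′ ≡ k → Dominates H H′ → Dominates H′ H → SameFamily H H′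
    same anti len anti′ len′ f g = Yes-determines anti anti′ (step₃ anti len anti′ len′ f g) (step₃ anti′ len′ anti len g f)

  module _ {G : Family (2 + m)} (sep : Separating (2 + m) k G) where

    -- The padding sets contain `i` and `j`, and `r < m` keeps them from being full.
    co-pair : ∀ i j → i ≢ j → co i ∈ₗ G ⊎ co j ∈ₗ G
    co-pair i j i≢j with F , anti , len , shape ← middle-antichain i≢j inside inside r (k ∸ 1) (k∸≤ ≤-refl) =
      top-pair sep i≢j anti (trans (cong suc len) (m+[n∸m]≡n (<⇒≤ 2≤k))) good
      where
      good : ∀ {Y} → Y ∈ₗ F → i ∈ Y × j ∈ Y × ¬ ⊤ ⊆ Y
      good Y∈ with Z , ∣Z∣≡r , refl ← shape Y∈
        with x , x∉Z ← ≢⊤⇒∃∉ {p = Z} (λ { refl → <-irrefl (trans (sym ∣Z∣≡r) (∣⊤∣≡n m)) r<m }) =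
          inside-∈ (lookup-insert₂ˡ i≢j inside inside Z) , inside-∈ (lookup-insert₂ʳ i≢j inside inside Z) ,
          (λ ⊤⊆Y → x∉Z (∈-insert₂⁻ i≢j inside inside Z (⊤⊆Y ∈⊤)))

    -- The padding sets avoid `a` and `b`, and `2 ≤ r` keeps them out of every singleton.
    singleton-pair : ∀ a b → a ≢ b → ⁅ a ⁆ ∈ₗ G ⊎ ⁅ b ⁆ ∈ₗ G
    singleton-pair a b a≢b with F , anti , len , shape ← middle-antichain a≢b outside outside r (k ∸ suc m) (k∸≤ (s≤s z≤n)) =
      bottom-pair sep a≢b anti (trans (cong ((2 + m) +_) len) (cong suc (m+[n∸m]≡n (<⇒≤ n≤k)))) good
      where
      good : ∀ {Y} → Y ∈ₗ F → a ∉ Y × b ∉ Y × (∀ j → ¬ Y ⊆ ⁅ j ⁆)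
      good Y∈ with Z , ∣Z∣≡r , refl ← shape Y∈
        with x , y , x≢y , x∈Z , y∈Z ← ∣p∣≥2⇒∃₂ Z (subst (2 ≤_) (sym ∣Z∣≡r) 2≤r) =
          outside-∉ (lookup-insert₂ˡ a≢b outside outside Z) , outside-∉ (lookup-insert₂ʳ a≢b outside outside Z) ,
          (λ j Y⊆j → x≢y (punchIn₂-injective a≢b (trans
            (x∈⁅y⁆⇒x≡y j (Y⊆j (∈-insert₂⁺ a≢b outside outside Z x∈Z)))
            (sym (x∈⁅y⁆⇒x≡y j (Y⊆j (∈-insert₂⁺ a≢b outside outside Z y∈Z)))))))

    -- `forced` with `A` as `⁅ x ⁆`. The padding contains `j`, so it is not below `Q ∪ ⁅ i ⁆`, and
    -- avoids `x`, so it is above neither `Q` nor a petal.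
    inner∈G : ∀ Q {x i j} → x ∈ Q → ¬ Q ⊆ ⁅ x ⁆ → i ∉ Q → j ∉ Q → j ≢ i → Q ∈ₗ G
    inner∈G Q {x} {i} {j} x∈Q Q⊈x i∉Q j∉Q j≢i
      with j≢x ← (λ (j≡x : j ≡ x) → j∉Q (subst (_∈ Q) (sym j≡x) x∈Q))
      with F , anti , len , shape ← middle-antichain j≢x inside outside r (k ∸ ∣ ∁ Q ∣)
             (k∸≤ (subst (1 ≤_) (length-elements (∁ Q)) (∈-length (∈-elements⁺ (x∉p⇒x∈∁p i∉Q))))) =
        forced sep i∉Q (⁅⁆-⊆ x∈Q) Q⊈x anti (trans (cong (∣ ∁ Q ∣ +_) len) (m+[n∸m]≡n (≤-trans (∣p∣≤n (∁ Q)) n≤k))) good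
      where
      good : ∀ {Y} → Y ∈ₗ F → ¬ Y ⊆ Q ∪ ⁅ i ⁆ × ¬ Q ⊆ Y × (∀ {l} → l ∉ Q → l ≢ i → Incomparable (⁅ x ⁆ ∪ ⁅ l ⁆) Y)
      good Y∈ with Z , ∣Z∣≡r , refl ← shape Y∈
        with z , z∈Z ← ∣p∣≥1⇒∃ Z (subst (1 ≤_) (sym ∣Z∣≡r) (<⇒≤ 2≤r)) =
          (λ sub → [ j∉Q , j≢i ]′ (∈-adjoin⁻ (sub j∈Y))) , (λ sub → x∉Y (sub x∈Q)) ,
          (λ {l} _ _ → (λ sub → x∉Y (sub (⊆-adjoin (x∈⁅x⁆ x)))) ,
            -- Below the petal at `l`, both `j` and the copy of `z` would have to be `l`.
            (λ sub → punchIn₂≢ˡ j≢x z (trans (is-l sub (∈-insert₂⁺ j≢x inside outside Z z∈Z) (punchIn₂≢ʳ j≢x z)) (sym (is-l sub j∈Y j≢x)))))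
        where
        j∈Y = inside-∈ (lookup-insert₂ˡ j≢x inside outside Z)
        x∉Y = outside-∉ (lookup-insert₂ʳ j≢x inside outside Z)
        is-l : ∀ {l y} {Y : Subset (2 + m)} → Y ⊆ ⁅ x ⁆ ∪ ⁅ l ⁆ → y ∈ Y → y ≢ x → y ≡ l
        is-l sub y∈Y y≢x = [ (λ y∈x → contradiction (x∈⁅y⁆⇒x≡y x y∈x) y≢x) , id ]′ (∈-adjoin⁻ (sub y∈Y))

    family⊆G : ∀ {i₀ a₀} → (∀ i → i ≢ i₀ → co i ∈ₗ G) → (∀ a → a ≢ a₀ → ⁅ a ⁆ ∈ₗ G) → ∀ {Q} → Q ∈ₗ family i₀ a₀ → Q ∈ₗ G
    family⊆G cos singles {Q} Q∈ with Q≢⊥ , Q≢⊤ , Q≢co , Q≢a ← ∈-family⁻ Q∈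
      with x , x∈Q , _ ← ⊆∧≢⇒∃ ⊥⊆ Q≢⊥
      with i , i∉Q ← ≢⊤⇒∃∉ Q≢⊤
      with Q ≟ₛ ⁅ x ⁆ | Q ≟ₛ co i
    ... | yes refl | _        = singles x (λ { refl → Q≢a refl })
    ... | no _     | yes refl = cos i (λ { refl → Q≢co refl })
    ... | no Q≢x   | no Q≢coi with j , j∉Q , j≢i ← ≢co⇒∃∉ i∉Q Q≢coi =
      inner∈G Q x∈Q (λ Q⊆x → Q≢x (⊆-antisym Q⊆x (⁅⁆-⊆ x∈Q))) i∉Q j∉Q j≢i

  h-large : ∀ i a → a ≢ i → (∀ x → ⁅ a ⁆ ∪ ⁅ x ⁆ ≢ co i) → hIs (2 + m) k (2 ^ (2 + m) ∸ 4)
  h-large i a a≢i edge≢co = (family i a , family-unique i a , length-family i a , separating i a a≢i edge≢co) , lower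
    where
    lower : ∀ (G : Family (2 + m)) → Unique G → Separating (2 + m) k G → 2 ^ (2 + m) ∸ 4 ≤ length G
    lower G _ sep with i₀ , cos ← ∃-all-but-one co G i (co-pair sep) | a₀ , singles ← ∃-all-but-one ⁅_⁆ G a (singleton-pair sep) =
      subst (_≤ length G) (length-family i₀ a₀) (Unique-⊆⇒length≤ (family-unique i₀ a₀) (family⊆G sep cos singles))

-- The third range and the assembly of the cases

-- For n = 3, 4, 5 the upper limits on `k` are 2, 3, 4, so the range is empty.
large-range : ∀ m {k} → 3 ≤ 2 + m → 2 + m ≤ k → k ≤ m C ⌊ m /2⌋ + 1 → 4 ≤ m
large-range 0 (s≤s (s≤s ())) _ _
large-range 1 _ lo hi = contradiction (≤-trans lo hi) (from-no (3 ≤? 2))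
large-range 2 _ lo hi = contradiction (≤-trans lo hi) (from-no (4 ≤? 3))
large-range 3 _ lo hi = contradiction (≤-trans lo hi) (from-no (5 ≤? 4))
large-range (suc (suc (suc (suc m)))) _ _ _ = s≤s (s≤s (s≤s (s≤s z≤n)))

-- Here i = 0 and a = 1: co 0 contains both 2 and 3, whereas ⁅ 1 ⁆ ∪ ⁅ x ⁆ does not.
edge≢co : ∀ {l} (x : Fin (4 + l)) → ⁅ suc zero ⁆ ∪ ⁅ x ⁆ ≢ co zero
edge≢co {l} x eq = contradiction (trans (≡x (λ ()) (λ ())) (sym (≡x (λ ()) (λ ())))) 2≢3
  where
  ≡x : ∀ {y : Fin (4 + l)} → y ≢ zero → y ≢ suc zero → y ≡ x
  ≡x {y} y≢0 y≢1 = [ (λ y∈ → contradiction (x∈⁅y⁆⇒x≡y (suc zero) y∈) y≢1) , id ]′ (∈-adjoin⁻ (subst (y ∈_) (sym eq) (∈-co⁺ y≢0)))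
  2≢3 : suc (suc zero) ≢ (Fin (4 + l) ∋ suc (suc (suc zero)))
  2≢3 ()

theorem1p2 : ∀ (n k : ℕ) → 3 ≤ n →
    (k ≡ 1 → hIs n k n)
    × (1 < k → k < n → hIs n k (binomSum n k ∸ 1))
    × (n ≤ k → k ≤ ((n ∸ 2) C (⌊ n /2⌋ ∸ 1)) + 1 → hIs n k (2 ^ n ∸ 4))
theorem1p2 1 k (s≤s ())
theorem1p2 (suc (suc m)) k 3≤n =
  (λ { refl → h-one (2 + m) }) ,
  (λ 1<k k<n → Small.h-small 1<k k<n zero) ,
  large
  where
  large : 2 + m ≤ k → k ≤ m C ⌊ m /2⌋ + 1 → hIs (2 + m) k (2 ^ (2 + m) ∸ 4)
  large lo hi with large-range m 3≤n lo hi
  -- Matching on the inequality exposes enough successors in n for the points 0 and 1 and for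
  -- `edge≢co`.
  ... | 4≤m@(s≤s (s≤s (s≤s (s≤s _)))) = Large.h-large 4≤m lo hi zero (suc zero) (λ ()) edge≢co
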